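{- For every integer $g\geq 3$ there exists a planar graph $G$ of girth at least $g$ such that $\chi_{\ell}^{\star}(G)=4$.
   Context: All graphs are finite and simple. A list-assignment of a graph $G$ is a map $L$ assigning to each vertex $v$ a finite set $L(v)\subseteq\mathbb{N}$; it is $k$-fold if $|L(v)|=k$ for all $v$. An $L$-coloring is a proper coloring $c$ of $G$ with $c(v)\in L(v)$ for all $v$. For a $k$-fold list-assignment $L$, an $L$-packing is a collection of $k$ $L$-colorings $c_1,\dots,c_k$ such that for every vertex $v$ the values $c_1(v),\dots,c_k(v)$ are pairwise distinct (so they exhaust $L(v)$). The list packing number $\chi_{\ell}^{\star}(G)$ is the least integer $k\geq1$ such that every $k$-fold list-assignment of $G$ admits an $L$-packing. -}

module Defs where

open import Level using (0ℓ)
open import Data.Nat.Base as ℕ using (ℕ; suc)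
open import Data.Fin.Base as Fin using (Fin; zero; suc; inject₁; fromℕ)
open import Data.List.Base using (List; length)
open import Data.List.Membership.Propositional using (_∈_)
open import Data.List.Relation.Unary.Unique.Propositional using (Unique)
open import Data.Product.Base using (∃; _×_; _,_)
open import Data.Rational.Base using (ℚ; 0ℚ; 1ℚ; _+_; _-_; _*_; _≤_)
open import Data.Sum.Base using (_⊎_)
open import Function.Definitions using (Injective)
open import Relation.Binary.Core using (Rel)
open import Relation.Binary.Definitions using (Symmetric; Irreflexive; Decidable)
open import Relation.Binary.PropositionalEquality.Core using (_≡_; _≢_)

record Graph : Set₁ where
  infix 4 _~_
  field
    order    : ℕ
    _~_      : Rel (Fin order) 0ℓ
    ~-sym    : Symmetric _~_
    ~-irrefl : Irreflexive _≡_ _~_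
    _~?_     : Decidable _~_

  Vertex : Set
  Vertex = Fin order

-- A cycle v₀ v₁ … vₘ v₀ on suc m ≥ 3 distinct vertices; its length is suc m.
record Cycle (G : Graph) (m : ℕ) : Set where
  open Graph G
  field
    2≤m      : 2 ℕ.≤ m
    vertex   : Fin (suc m) → Vertex
    distinct : Injective _≡_ _≡_ vertex
    step     : ∀ (i : Fin m) → vertex (inject₁ i) ~ vertex (suc i)
    close    : vertex (fromℕ m) ~ vertex zero

-- Forests have infinite girth, hence satisfy this for every g.
GirthAtLeast : ℕ → Graph → Set
GirthAtLeast g G = ∀ {m} → Cycle G m → g ℕ.≤ suc m

-- A graph is planar if it has a drawing without crossings whose edges
-- are simple polygonal arcs.  Every finite planar graph has such a drawing with all
-- vertices and bends at rational points.  Segments between rational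
-- points which meet at all in the real plane also meet at a rational
-- point (and if they have two common points, at two rational ones), so
-- it is enough to test disjointness on rational points.

Point : Set
Point = ℚ × ℚ

OnSegment : Point → Point → Point → Set
OnSegment (px , py) (qx , qy) x = ∃ λ (t : ℚ) →
  0ℚ ≤ t × t ≤ 1ℚ ×
  x ≡ ((1ℚ - t) * px + t * qx , (1ℚ - t) * py + t * qy)

data Polyline : Point → Point → Set where
  segment : ∀ p q → Polyline p q
  bend    : ∀ p {r q} → Polyline r q → Polyline p q

OnPolyline : ∀ {p q} → Polyline p q → Point → Set
OnPolyline (segment p q)    x = OnSegment p q x
OnPolyline (bend p {r} rest) x = OnSegment p r x ⊎ OnPolyline rest x

-- The polyline is an arc: it is non-degenerate and does not meet itself.
Simple : ∀ {p q} → Polyline p q → Set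
Simple (segment p q)     = p ≢ q
Simple (bend p {r} rest) =
  p ≢ r × Simple rest ×
  (∀ x → OnSegment p r x → OnPolyline rest x → x ≡ r)

record PlaneDrawing (G : Graph) : Set where
  open Graph G
  field
    position     : Vertex → Point
    position-inj : Injective _≡_ _≡_ position

    -- The edge {u , v} with u < v is drawn as arc u v.  The values of arc
    -- at all other pairs are irrelevant.
    arc : ∀ u v → Polyline (position u) (position v)

  Edge : Vertex → Vertex → Set
  Edge u v = u Fin.< v × u ~ v

  field
    arc-simple : ∀ {u v} → Edge u v → Simple (arc u v)

    arc-avoids-vertices : ∀ {u v} → Edge u v →
      ∀ w → OnPolyline (arc u v) (position w) → w ≡ u ⊎ w ≡ v

    -- By arc-avoids-vertices, w is then a common end of the two edges.
    no-crossing : ∀ {u v u′ v′} → Edge u v → Edge u′ v′ →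
      (u , v) ≢ (u′ , v′) →
      ∀ x → OnPolyline (arc u v) x → OnPolyline (arc u′ v′) x →
      ∃ λ w → x ≡ position w

Planar : Graph → Set
Planar = PlaneDrawing

record FinSet : Set where
  field
    elements : List ℕ
    unique   : Unique elements

  size : ℕ
  size = length elements

infix 4 _∈ˢ_
_∈ˢ_ : ℕ → FinSet → Set
a ∈ˢ S = a ∈ FinSet.elements S

module _ (G : Graph) where
  open Graph G

  ListAssignment : Set
  ListAssignment = Vertex → FinSet

  IsFold : ℕ → ListAssignment → Set
  IsFold k L = ∀ v → FinSet.size (L v) ≡ k

  record IsListColoring (L : ListAssignment) (c : Vertex → ℕ) : Set where
    field
      proper    : ∀ {u v} → u ~ v → c u ≢ c v
      from-list : ∀ v → c v ∈ˢ L v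

  record Packing (k : ℕ) (L : ListAssignment) : Set where
    field
      coloring   : Fin k → Vertex → ℕ
      isColoring : ∀ i → IsListColoring L (coloring i)
      disjoint   : ∀ v {i j} → i ≢ j → coloring i v ≢ coloring j v

  AllPackable : ℕ → Set
  AllPackable k = ∀ (L : ListAssignment) → IsFold k L → Packing k L

  IsListPackingNumber : ℕ → Set
  IsListPackingNumber k =
    1 ℕ.≤ k × AllPackable k × (∀ j → 1 ℕ.≤ j → AllPackable j → k ℕ.≤ j)

{-# OPTIONS --safe #-}
module Submission where

-- Consider lists among A = {1,2,3}, B = {1,2,4} and C = {1,3,4}.  A packing assigns to every
-- vertex a permutation of its list.  Along an edge whose ends have the same list it changes by
-- a 3-cycle, so its sign is preserved along paths of constant list, however long.  Along an
-- edge between different lists X and Y whose permutations have opposite signs (after replacing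
-- the private colour of X by that of Y), the two private colours occur at the same index.
-- Hence on an odd cycle with lists X Y X Y … X whose X-vertices all have the same sign, and
-- whose Y-vertices too, these signs cannot be opposite: the index of the private colour would
-- be constant along the cycle, which the edge X X excludes.  The three substitutions
-- A → B → C → A compose to a transposition, so one of the pairs AB, BC, CA has opposite signs.
-- A graph containing such a cycle for each pair, with the signs synchronised by long paths of
-- constant list, therefore has no packing.
--
-- The graph is 2-degenerate, hence packable with 4 colours, and of large girth for the same
-- reason: its vertices can be ranked such that each has at most two neighbours of lower rank,
-- and where there are two, one of them continues a long path on which a cycle has no choice.

open import Defs
open import Data.Nat.Base using (ℕ; _≤_)
open import Data.Product.Base using (∃; _×_)

open import Data.Bool.Base using (Bool; true; false; not; _xor_)
import Data.Bool.Properties as Bool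
open import Data.Empty using (⊥; ⊥-elim)
open import Data.Fin.Base as Fin using (Fin; zero; suc; toℕ; fromℕ<; _↑ˡ_; _↑ʳ_; splitAt; join; combine; remQuot)
open import Data.Fin.Patterns using (0F; 1F; 2F; 3F; 4F; 5F)
open import Data.Fin.Permutation using (Permutation′; _⟨$⟩ʳ_; _⟨$⟩ˡ_; inverseˡ; inverseʳ; transpose; _∘ₚ_) renaming (id to idₚ)
open import Data.Fin.Properties as Fin using (all?; any?; toℕ<n; toℕ-fromℕ<; toℕ-injective; toℕ-inject₁; toℕ-fromℕ; toℕ-↑ˡ; toℕ-↑ʳ;
  toℕ-combine; splitAt-↑ˡ; splitAt-↑ʳ; join-splitAt; remQuot-combine; combine-remQuot)
import Data.Integer.Base as ℤ
import Data.Integer.Properties as ℤ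
open import Data.List.Base as List using (List; []; _∷_)
open import Data.List.Membership.Propositional using (_∈_)
open import Data.List.Membership.Propositional.Properties using (∈-lookup)
import Data.List.Relation.Unary.All as All
open All using ([]; _∷_)
open import Data.List.Relation.Unary.AllPairs.Core using ([]; _∷_)
open import Data.List.Relation.Unary.Any using (here; there)
open import Data.List.Relation.Unary.Unique.Propositional using (Unique)
open import Data.Nat.Base as ℕ using (zero; suc; _+_; _*_; _∸_; _⊓_; _<_; z≤n; s≤s; NonZero)
open import Data.Nat.Coprimality as Coprimality using (1-coprimeTo)
open import Data.Nat.DivMod
open import Data.Nat.Properties as ℕ
open import Data.Nat.Solver using (module +-*-Solver)
open import Data.Product.Base using (∃₂; _,_; proj₁; proj₂)
open import Data.Rational.Base as ℚ using (ℚ; mkℚ; 0ℚ; 1ℚ)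
import Data.Rational.Properties as ℚ
open import Data.Rational.Solver using () renaming (module +-*-Solver to ℚ-Solver)
open import Data.Sum.Base using (_⊎_; inj₁; inj₂; swap)
open import Data.Vec.Base as Vec using (Vec; []; _∷_)
open import Function.Base using (_∘_)
open import Function.Definitions using (Injective)
open import Relation.Binary.Definitions using (Tri; tri<; tri≈; tri>)
open import Relation.Binary.PropositionalEquality
open import Relation.Nullary using (¬_; Dec; yes; no)
open import Relation.Nullary.Decidable using (from-yes; map′; _→-dec_; _×-dec_; _⊎-dec_; ¬?)
open import Relation.Nullary.Negation using (contradiction)

-- Packings of 2-degenerate graphs

module _ {n} {ℓ p : Fin n → ℕ} (ℓ-inj : Injective _≡_ _≡_ ℓ) (p-inj : Injective _≡_ _≡_ p) where

  Extends : ℕ → Permutation′ n → Set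
  Extends k π = ∀ i → toℕ i < k → ∀ a → ℓ a ≡ p i → π ⟨$⟩ʳ i ≡ a

  -- The indices are treated in increasing order. If `p` takes a value `ℓ b` at the new index `c`,
  -- precomposing with the swap of `c` and the preimage of `b` sends `c` to `b`.
  extend : ∀ k → k ≤ n → ∃ (Extends k)
  extend zero    _   = idₚ , λ _ ()
  extend (suc k) k<n with extend k (<⇒≤ k<n)
  ... | π , ext with any? (λ a → ℓ a ≟ p (fromℕ< k<n))
  ...   | no none = π , ext′
    where
    ext′ : Extends (suc k) π
    ext′ i i≤k a eq with toℕ i ≟ k
    ... | no i≢k   = ext i (≤∧≢⇒< (ℕ.s≤s⁻¹ i≤k) i≢k) a eq
    ... | yes refl = ⊥-elim (none (a , trans eq (cong p (toℕ-injective (sym (toℕ-fromℕ< k<n))))))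
  ...   | yes (b , hit) = ρ , ext′
    where
    c = fromℕ< k<n
    j = π ⟨$⟩ˡ b
    ρ = transpose c j ∘ₚ π
    ext′ : Extends (suc k) ρ
    ext′ i i≤k a eq with i Fin.≟ c
    ... | yes refl = trans (inverseʳ π) (ℓ-inj (trans hit (sym eq)))
    ... | no i≢c with i Fin.≟ j
    ...   | no i≢j = ext i (≤∧≢⇒< (ℕ.s≤s⁻¹ i≤k) λ { refl → i≢c (toℕ-injective (sym (toℕ-fromℕ< k<n))) }) a eq
    -- The swap spoils no earlier constraint: an earlier index bound to `b` would have the same
    -- value of `p` as `c`.
    ...   | yes i≡j = ⊥-elim (i≢c (p-inj (trans (sym eq) (trans (cong ℓ a≡b) hit))))
      where
      a≡b = trans (sym (ext i (≤∧≢⇒< (ℕ.s≤s⁻¹ i≤k) λ { refl → i≢c (toℕ-injective (sym (toℕ-fromℕ< k<n))) }) a eq))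
                  (trans (cong (π ⟨$⟩ʳ_) i≡j) (inverseʳ π))

  complete : ∃ λ (π : Permutation′ n) → ∀ i a → ℓ a ≡ p i → π ⟨$⟩ʳ i ≡ a
  complete with extend n ≤-refl
  ... | π , ext = π , λ i → ext i (toℕ<n i)

abstract
  -- These are all the derangements of four points.
  derangements : Vec (Vec (Fin 4) 4) 9
  derangements =
    (1F ∷ 0F ∷ 3F ∷ 2F ∷ []) ∷ (1F ∷ 2F ∷ 3F ∷ 0F ∷ []) ∷ (1F ∷ 3F ∷ 0F ∷ 2F ∷ []) ∷
    (2F ∷ 0F ∷ 3F ∷ 1F ∷ []) ∷ (2F ∷ 3F ∷ 0F ∷ 1F ∷ []) ∷ (2F ∷ 3F ∷ 1F ∷ 0F ∷ []) ∷
    (3F ∷ 0F ∷ 1F ∷ 2F ∷ []) ∷ (3F ∷ 2F ∷ 0F ∷ 1F ∷ []) ∷ (3F ∷ 2F ∷ 1F ∷ 0F ∷ []) ∷ []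

  derangement : Fin 9 → Fin 4 → Fin 4
  derangement k = Vec.lookup (Vec.lookup derangements k)

  derangement-injective : ∀ k i j → derangement k i ≡ derangement k j → i ≡ j
  derangement-injective = from-yes (all? λ k → all? λ i → all? λ j →
    (derangement k i Fin.≟ derangement k j) →-dec (i Fin.≟ j))

  derangement-moves : ∀ k i → derangement k i ≢ i
  derangement-moves = from-yes (all? λ k → all? λ i → ¬? (derangement k i Fin.≟ i))

  -- Each position excludes at most two of the four values, and each value is excluded at no more
  -- than two positions, so Hall's condition holds. This is where four colours suffice against two
  -- neighbours. The proof is by exhaustion.
  derangement-avoiding : ∀ a b c d → a ≢ b → a ≢ c → a ≢ d → b ≢ c → b ≢ d → c ≢ d →
    ∃ λ k → ∀ i → derangement k i ≢ Vec.lookup (a ∷ b ∷ c ∷ d ∷ []) i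
  derangement-avoiding = from-yes (all? λ a → all? λ b → all? λ c → all? λ d →
    ¬? (a Fin.≟ b) →-dec (¬? (a Fin.≟ c) →-dec (¬? (a Fin.≟ d) →-dec
    (¬? (b Fin.≟ c) →-dec (¬? (b Fin.≟ d) →-dec (¬? (c Fin.≟ d) →-dec
    any? λ k → all? λ i → ¬? (derangement k i Fin.≟ Vec.lookup (a ∷ b ∷ c ∷ d ∷ []) i)))))))

⟨$⟩ʳ-injective : ∀ {n} (π : Permutation′ n) → Injective _≡_ _≡_ (π ⟨$⟩ʳ_)
⟨$⟩ʳ-injective π eq = trans (sym (inverseˡ π)) (trans (cong (π ⟨$⟩ˡ_) eq) (inverseˡ π))

⟨$⟩ˡ-injective : ∀ {n} (π : Permutation′ n) → Injective _≡_ _≡_ (π ⟨$⟩ˡ_)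
⟨$⟩ˡ-injective π eq = trans (sym (inverseʳ π)) (trans (cong (π ⟨$⟩ʳ_) eq) (inverseʳ π))

record Avoiding (ℓ p q : Fin 4 → ℕ) : Set where
  field
    choice    : Fin 4 → Fin 4
    injective : Injective _≡_ _≡_ choice
    avoids₁   : ∀ i → ℓ (choice i) ≢ p i
    avoids₂   : ∀ i → ℓ (choice i) ≢ q i

abstract
  -- Completing the partial matchings "ℓ a = p i" and "ℓ a = q i" to permutations π and ρ,
  -- the choice π ∘ τ works for any derangement τ that also avoids π⁻¹ ∘ ρ.
  avoid-two : {ℓ p q : Fin 4 → ℕ} →
    Injective _≡_ _≡_ ℓ → Injective _≡_ _≡_ p → Injective _≡_ _≡_ q → Avoiding ℓ p q
  avoid-two {ℓ} {p} {q} ℓ-inj p-inj q-inj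
    with complete ℓ-inj p-inj | complete ℓ-inj q-inj
  ... | π , π-ext | ρ , ρ-ext = solution (derangement-avoiding (σ 0F) (σ 1F) (σ 2F) (σ 3F)
          (σ-distinct λ ()) (σ-distinct λ ()) (σ-distinct λ ())
          (σ-distinct λ ()) (σ-distinct λ ()) (σ-distinct λ ()))
    where
    σ : Fin 4 → Fin 4
    σ i = π ⟨$⟩ˡ (ρ ⟨$⟩ʳ i)

    σ-distinct : ∀ {i j} → i ≢ j → σ i ≢ σ j
    σ-distinct i≢j eq = i≢j (⟨$⟩ʳ-injective ρ (⟨$⟩ˡ-injective π eq))

    tabulated : ∀ i → Vec.lookup (σ 0F ∷ σ 1F ∷ σ 2F ∷ σ 3F ∷ []) i ≡ σ i
    tabulated 0F = refl
    tabulated 1F = refl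
    tabulated 2F = refl
    tabulated 3F = refl

    solution : (∃ λ k → ∀ i → derangement k i ≢ Vec.lookup (σ 0F ∷ σ 1F ∷ σ 2F ∷ σ 3F ∷ []) i) → Avoiding ℓ p q
    solution (k , avoids) = record
      { choice    = λ i → π ⟨$⟩ʳ derangement k i
      ; injective = λ eq → derangement-injective k _ _ (⟨$⟩ʳ-injective π eq)
      ; avoids₁   = λ i eq → derangement-moves k i (⟨$⟩ʳ-injective π (sym (π-ext i _ eq)))
      ; avoids₂   = λ i eq → avoids i (trans (sym (inverseˡ π))
                      (trans (cong (π ⟨$⟩ˡ_) (sym (ρ-ext i _ eq))) (sym (tabulated i))))
      }

lookup-injective : ∀ {xs : List ℕ} → Unique xs → Injective _≡_ _≡_ (List.lookup xs)
lookup-injective (_ ∷ _)    {zero}  {zero}  _  = refl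
lookup-injective (x∉ ∷ _)   {zero}  {suc j} eq = contradiction eq (All.lookup x∉ (∈-lookup j))
lookup-injective (x∉ ∷ _)   {suc i} {zero}  eq = contradiction (sym eq) (All.lookup x∉ (∈-lookup i))
lookup-injective (_ ∷ uniq) {suc i} {suc j} eq = cong suc (lookup-injective uniq eq)

module _ (A : FinSet) where
  open FinSet A

  nth : ∀ {k} → size ≡ k → Fin k → ℕ
  nth refl = List.lookup elements

  nth-injective : ∀ {k} (eq : size ≡ k) → Injective _≡_ _≡_ (nth eq)
  nth-injective refl = lookup-injective unique

  nth-∈ : ∀ {k} (eq : size ≡ k) i → nth eq i ∈ˢ A
  nth-∈ refl = ∈-lookup

module _ (G : Graph) where
  open Graph G

  module _ (rank : Vertex → ℕ)
    (rank-proper : ∀ {u v} → u ~ v → rank u ≢ rank v)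
    (at-most-two : ∀ {v a b c} → a ~ v × rank a < rank v → b ~ v × rank b < rank v → c ~ v × rank c < rank v →
      a ≡ b ⊎ a ≡ c ⊎ b ≡ c)
    where

    lower-pair : ∀ v → ∃₂ λ a b → ∀ {u} → u ~ v → rank u < rank v → u ≡ a ⊎ u ≡ b
    lower-pair v with any? (λ u → u ~? v ×-dec rank u <? rank v)
    -- Without lower neighbours `v` itself fills the pair; its row is injective, which is all that
    -- `avoid-two` asks of it.
    ... | no none = v , v , λ u~v u<v → ⊥-elim (none (_ , u~v , u<v))
    ... | yes (a , a<v) with any? (λ u → (u ~? v ×-dec rank u <? rank v) ×-dec ¬? (u Fin.≟ a))
    ...   | yes (b , b<v , b≢a) = a , b , λ u~v u<v → among (at-most-two a<v b<v (u~v , u<v))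
      where
      among : ∀ {u} → a ≡ b ⊎ a ≡ u ⊎ b ≡ u → u ≡ a ⊎ u ≡ b
      among (inj₁ refl)        = ⊥-elim (b≢a refl)
      among (inj₂ (inj₁ refl)) = inj₁ refl
      among (inj₂ (inj₂ refl)) = inj₂ refl
    ...   | no none = a , a , λ {u} u~v u<v → inj₁ (only u (u~v , u<v))
      where
      only : ∀ u → u ~ v × rank u < rank v → u ≡ a
      only u u<v with u Fin.≟ a
      ... | yes eq = eq
      ... | no u≢a = ⊥-elim (none (u , u<v , u≢a))

    private
      lower₁ lower₂ : Vertex → Vertex
      lower₁ v = proj₁ (lower-pair v)
      lower₂ v = proj₁ (proj₂ (lower-pair v))

      lower : ∀ {u v} → u ~ v → rank u < rank v → u ≡ lower₁ v ⊎ u ≡ lower₂ v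
      lower {v = v} = proj₂ (proj₂ (lower-pair v))

    module _ (L : ListAssignment G) (L-fold : IsFold G 4 L) where

      option : Vertex → Fin 4 → ℕ
      option v = nth (L v) (L-fold v)

      option-injective : ∀ v → Injective _≡_ _≡_ (option v)
      option-injective v = nth-injective (L v) (L-fold v)

      Choice : Set
      Choice = Vertex → Fin 4 → Fin 4

      -- Rows are injective at every vertex, treated or not, so that `avoid-two` applies at each of
      -- them. Only edges whose upper end has been treated are separated.
      record PackedBelow (r : ℕ) (f : Choice) : Set where
        field
          inj : ∀ v → Injective _≡_ _≡_ (f v)
          sep : ∀ {u v} → u ~ v → rank u < rank v → rank v < r → ∀ i → option u (f u i) ≢ option v (f v i)

      pack : ∀ r → ∃ (PackedBelow r)
      pack zero = (λ _ i → i) , record { inj = λ _ eq → eq ; sep = λ _ _ () }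
      pack (suc r) with pack r
      ... | f , packed = f′ , record { inj = inj′ ; sep = sep′ }
        where
        open PackedBelow packed

        row : Vertex → Fin 4 → ℕ
        row v = option v ∘ f v

        row-injective : ∀ v → Injective _≡_ _≡_ (row v)
        row-injective v = inj v ∘ option-injective v

        new : ∀ v → Avoiding (option v) (row (lower₁ v)) (row (lower₂ v))
        new v = avoid-two (option-injective v) (row-injective (lower₁ v)) (row-injective (lower₂ v))

        f′ : Choice
        f′ v with rank v ≟ r
        ... | yes _ = Avoiding.choice (new v)
        ... | no  _ = f v

        inj′ : ∀ v → Injective _≡_ _≡_ (f′ v)
        inj′ v with rank v ≟ r
        ... | yes _ = Avoiding.injective (new v)
        ... | no  _ = inj v

        sep′ : ∀ {u v} → u ~ v → rank u < rank v → rank v < suc r →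
          ∀ i → option u (f′ u i) ≢ option v (f′ v i)
        sep′ {u} {v} u~v u<v v≤r i with rank u ≟ r | rank v ≟ r
        -- All vertices of rank `r` are rechosen at once. This is sound because the lower end of an
        -- edge treated so far has rank below `r` and keeps its row.
        ... | yes refl | _      = contradiction u<v (≤⇒≯ (ℕ.s≤s⁻¹ v≤r))
        ... | no _     | no v≢r = sep u~v u<v (≤∧≢⇒< (ℕ.s≤s⁻¹ v≤r) v≢r) i
        ... | no _     | yes _ with lower u~v u<v
        ...   | inj₁ u≡ = λ eq → Avoiding.avoids₁ (new v) i (trans (sym eq) (cong (λ u → row u i) u≡))
        ...   | inj₂ u≡ = λ eq → Avoiding.avoids₂ (new v) i (trans (sym eq) (cong (λ u → row u i) u≡))

    max-rank : ∀ {n} (f : Fin n → ℕ) → ∃ λ b → ∀ i → f i < b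
    max-rank {zero}  f = 0 , λ ()
    max-rank {suc n} f with max-rank (f ∘ suc)
    ... | b , bound = suc (f zero) ℕ.⊔ b , λ
      { zero    → m≤m⊔n _ b
      ; (suc i) → ≤-trans (bound i) (m≤n⊔m _ b) }

    2-degenerate⇒4-packable : AllPackable G 4
    2-degenerate⇒4-packable L L-fold with max-rank rank
    ... | b , bound with pack L L-fold b
    ...   | f , packed = record
      { coloring   = λ i v → option L L-fold v (f v i)
      ; isColoring = λ i → record
        { proper    = λ u~v → proper u~v i
        ; from-list = λ v → nth-∈ (L v) (L-fold v) _ }
      ; disjoint   = λ v i≢j eq → i≢j (inj v (option-injective L L-fold v eq))
      }
      where
      open PackedBelow packed
      proper : ∀ {u v} → u ~ v → ∀ i → option L L-fold u (f u i) ≢ option L L-fold v (f v i)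
      proper {u} {v} u~v i with <-cmp (rank u) (rank v)
      ... | tri< u<v _ _ = sep u~v u<v (bound v) i
      ... | tri≈ _ u≡v _ = ⊥-elim (rank-proper u~v u≡v)
      ... | tri> _ _ v<u = sep (~-sym u~v) v<u (bound u) i ∘ sym

-- Girth

argmax : ∀ {n} (f : Fin (suc n) → ℕ) → ∃ λ i → ∀ j → f j ≤ f i
argmax {zero}  f = zero , λ { zero → ≤-refl }
argmax {suc n} f with argmax (f ∘ suc)
... | i , max with ≤-total (f zero) (f (suc i))
...   | inj₁ 0≤i = suc i , λ { zero → 0≤i ; (suc j) → max j }
...   | inj₂ i≤0 = zero  , λ { zero → ≤-refl ; (suc j) → ≤-trans (max j) i≤0 }

module CyclicWalk {G : Graph} {m} (C : Cycle G m) where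
  open Graph G
  open Cycle C
  open +-*-Solver using (solve; _:+_; _:*_; _:=_; con)

  L = suc m

  -- The cycle unrolled into a periodic walk, which can be started at any vertex and followed in
  -- both directions.
  at : ℕ → Vertex
  at k = vertex (k mod L)

  at-cong : ∀ k l → k % L ≡ l % L → at k ≡ at l
  at-cong k l eq = cong vertex (toℕ-injective
    (trans (toℕ-fromℕ< (m%n<n k L)) (trans eq (sym (toℕ-fromℕ< (m%n<n l L))))))

  at-injective : ∀ k l → at k ≡ at l → k % L ≡ l % L
  at-injective k l eq = trans (sym (toℕ-fromℕ< (m%n<n k L)))
    (trans (cong toℕ (distinct eq)) (toℕ-fromℕ< (m%n<n l L)))

  at-toℕ : ∀ i → at (toℕ i) ≡ vertex i
  at-toℕ i = cong vertex (toℕ-injective (trans (toℕ-fromℕ< (m%n<n (toℕ i) L)) (m<n⇒m%n≡m (toℕ<n i))))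

  at-period : ∀ k j → at (k + j * L) ≡ at k
  at-period k j = at-cong (k + j * L) k ([m+kn]%n≡m%n k j L)

  shift-% : ∀ j k l → k % L ≡ l % L → (j + k) % L ≡ (j + l) % L
  shift-% j k l eq = trans (%-distribˡ-+ j k L)
    (trans (cong (λ r → (j % L + r) % L) eq) (sym (%-distribˡ-+ j l L)))

  step-at : ∀ k → at k ~ at (suc k)
  step-at k = subst₂ _~_ (at-cong (k % L) k (m%n%n≡m%n k L))
                (at-cong (suc (k % L)) (suc k) (shift-% 1 (k % L) k (m%n%n≡m%n k L)))
                (small (k % L) (m%n<n k L))
    where
    small : ∀ r → r < L → at r ~ at (suc r)
    small r r<L with r ℕ.<? m
    ... | yes r<m = subst₂ _~_
            (trans (sym (at-toℕ _)) (cong at (trans (toℕ-inject₁ i) (toℕ-fromℕ< r<m))))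
            (trans (sym (at-toℕ _)) (cong (at ∘ suc) (toℕ-fromℕ< r<m))) (step i)
      where i = fromℕ< r<m
    ... | no r≮m = subst₂ _~_
            (trans (sym (at-toℕ _)) (cong at (trans (toℕ-fromℕ m) (sym r≡m))))
            (trans (sym (at-toℕ zero)) (at-cong 0 (suc r) (sym (trans (cong (λ x → suc x % L) r≡m) (n%n≡0 L))))) close
      where r≡m = ≤-antisym (ℕ.s≤s⁻¹ r<L) (≮⇒≥ r≮m)

  -- The unrolled walk never turns back, because its period is at least 3 and so does not divide 2.
  at+2≢at : ∀ k → at (2 + k) ≢ at k
  at+2≢at k eq = contradiction 2≡0 λ ()
    where
    -- Adding `k * m` to both indices cancels `k`, since `k * m + k` is a multiple of `L`.
    shifted : (2 + k * L) % L ≡ 0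
    shifted = begin
      (2 + k * L) % L       ≡⟨ cong (_% L) (solve 2 (λ k m → con 2 :+ k :* (con 1 :+ m) := k :* m :+ (con 2 :+ k)) refl k m) ⟩
      (k * m + (2 + k)) % L ≡⟨ shift-% (k * m) (2 + k) k (at-injective (2 + k) k eq) ⟩
      (k * m + k) % L       ≡⟨ cong (_% L) (solve 2 (λ k m → k :* m :+ k := k :* (con 1 :+ m)) refl k m) ⟩
      (k * L) % L           ≡⟨ m*n%n≡0 k L ⟩
      0                     ∎
      where open ≡-Reasoning
    2≡0 : 2 ≡ 0
    2≡0 = trans (sym (m<n⇒m%n≡m (s≤s 2≤m))) (trans (sym ([m+kn]%n≡m%n 2 k L)) shifted)

module _ (G : Graph) where
  open Graph G

  module _ (rank : Vertex → ℕ)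
    (rank-proper : ∀ {u v} → u ~ v → rank u ≢ rank v)
    {A : Set} {κ : Vertex → A} (κ-injective : Injective _≡_ _≡_ κ)
    where

    -- A walk of g vertices from v through u in which the continuation is forced
    -- for a non-backtracking walk staying below the rank of v.
    record ForcedRun (g : ℕ) (v u : Vertex) : Set where
      field
        run    : ℕ → A
        run-0  : κ v ≡ run 0
        run-1  : κ u ≡ run 1
        fresh  : ∀ j → suc j < g → run (suc j) ≢ run 0
        forced : ∀ j → 2 + j < g → ∀ {x y} → κ x ≡ run (suc j) → x ~ y → rank y ≤ rank v →
                 κ y ≡ run j ⊎ κ y ≡ run (2 + j)

    -- By induction the walk follows the run as long as the run is forced, and the run does not come
    -- back to its start within that range.
    closed-walk-length : ∀ {g v u} → ForcedRun g v u →
      (w : ℕ → Vertex) → w 0 ≡ v → w 1 ≡ u →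
      (∀ j → w j ~ w (suc j)) → (∀ j → w (2 + j) ≢ w j) → (∀ j → rank (w j) ≤ rank v) →
      ∀ l → w (suc l) ≡ w 0 → g ≤ suc l
    closed-walk-length {g} {v} forcedRun w refl refl adj turn below l closed with g ≤? suc l
    ... | yes g≤ = g≤
    ... | no g≰  = ⊥-elim (fresh l (≰⇒> g≰)
                     (trans (sym (proj₂ (follow l (≰⇒> g≰)))) (trans (cong κ closed) run-0)))
      where
      open ForcedRun forcedRun
      follow : ∀ j → suc j < g → κ (w j) ≡ run j × κ (w (suc j)) ≡ run (suc j)
      follow zero    _  = run-0 , run-1
      follow (suc j) lt with follow j (<-trans (n<1+n _) lt)
      ... | κwj , κwj+1 with forced j lt κwj+1 (adj (suc j)) (below (2 + j))
      ...   | inj₁ back  = ⊥-elim (turn j (κ-injective (trans back (sym κwj))))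
      ...   | inj₂ forth = κwj+1 , forth

    -- A vertex of maximal rank on the cycle has two distinct lower neighbours there. The cycle is
    -- traversed from it in the direction in which the walk is forced.
    girth : ∀ {g} →
      (∀ {v u₁ u₂} → u₁ ~ v → u₂ ~ v → rank u₁ < rank v → rank u₂ < rank v → u₁ ≢ u₂ →
        ForcedRun g v u₁ ⊎ ForcedRun g v u₂) →
      GirthAtLeast g G
    girth {g} forcedRuns {m} C = from (forcedRuns
        (~-sym (step-at a)) (back-step 0) (lower {suc a} (step-at a)) (lower {m + a} (~-sym (back-step 0)))
        forward≢backward)
      where
      open CyclicWalk C
      open Cycle C
      open +-*-Solver using (solve; _:+_; _:*_; _:=_; con)
      top = argmax (rank ∘ vertex)
      a   = toℕ (proj₁ top)
      v   = at a

      below : ∀ k → rank (at k) ≤ rank v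
      below k = ≤-trans (proj₂ top (k mod L)) (≤-reflexive (cong rank (sym (at-toℕ (proj₁ top)))))

      lower : ∀ {k} → v ~ at k → rank (at k) < rank v
      lower {k} v~k = ≤∧≢⇒< (below k) (rank-proper (~-sym v~k))

      forward backward : ℕ → Vertex
      -- Since `m` is congruent to -1 modulo `L`, adding `m` in `backward` moves one step back
      -- without any subtraction.
      forward j  = at (j + a)
      backward j = at (j * m + a)

      m+1 : ∀ k → at (suc (m + k)) ≡ at k
      m+1 k = trans (cong at (solve 2 (λ m k → con 1 :+ (m :+ k) := k :+ con 1 :* (con 1 :+ m)) refl m k)) (at-period k 1)

      shift-at : ∀ j k l → at k ≡ at l → at (j + k) ≡ at (j + l)
      shift-at j k l eq = at-cong (j + k) (j + l) (shift-% j k l (at-injective k l eq))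

      back-step : ∀ j → at (m + (j * m + a)) ~ at (j * m + a)
      back-step j = subst (at (m + (j * m + a)) ~_) (m+1 _) (step-at _)

      forward≢backward : at (suc a) ≢ at (m + a)
      forward≢backward eq = at+2≢at a (trans (shift-at 1 (suc a) (m + a) eq) (m+1 a))

      back-turn : ∀ j → backward (2 + j) ≢ backward j
      back-turn j eq = at+2≢at k (begin
        at (2 + k)             ≡⟨ shift-at 2 (m + (m + k)) k eq′ ⟨
        at (2 + (m + (m + k))) ≡⟨ cong at (solve 2 (λ m k → con 2 :+ (m :+ (m :+ k)) := k :+ con 2 :* (con 1 :+ m)) refl m k) ⟩
        at (k + 2 * L)         ≡⟨ at-period k 2 ⟩
        at k                   ∎)
        where
        open ≡-Reasoning
        k = j * m + a
        eq′ : at (m + (m + k)) ≡ at k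
        eq′ = trans (cong at (solve 3 (λ m j a → m :+ (m :+ (j :* m :+ a)) := m :+ (m :+ j :* m) :+ a) refl m j a)) eq

      from : ForcedRun g v (at (suc a)) ⊎ ForcedRun g v (at (m + a)) → g ≤ suc m
      from (inj₁ forcedRun) = closed-walk-length forcedRun forward refl refl
        (λ j → step-at (j + a)) (λ j → at+2≢at (j + a)) (λ j → below (j + a)) m (m+1 a)
      from (inj₂ forcedRun) = closed-walk-length forcedRun backward refl
        (cong (λ k → at (k + a)) (*-identityˡ m))
        (λ j → ~-sym (subst (λ k → at k ~ backward j) (sym (+-assoc m (j * m) a)) (back-step j)))
        back-turn (λ j → below (j * m + a)) m
        (trans (cong at (solve 2 (λ m a → (con 1 :+ m) :* m :+ a := a :+ m :* (con 1 :+ m)) refl m a)) (at-period a m))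

-- Rational points between grid lines

ι : ℕ → ℚ
ι n = mkℚ (ℤ.+ n) 0 (Coprimality.sym (1-coprimeTo n))

ι-mono-≤ : ∀ {m n} → m ≤ n → ι m ℚ.≤ ι n
ι-mono-≤ m≤n = ℚ.*≤* (ℤ.*-monoʳ-≤-nonNeg (ℤ.+ 1) (ℤ.+≤+ m≤n))

ι-mono-< : ∀ {m n} → m < n → ι m ℚ.< ι n
ι-mono-< m<n = ℚ.*<* (ℤ.*-monoʳ-<-pos (ℤ.+ 1) (ℤ.+<+ m<n))

ι-cancel-≤ : ∀ {m n} → ι m ℚ.≤ ι n → m ≤ n
ι-cancel-≤ {m} {n} le with m ≤? n
... | yes m≤n = m≤n
... | no m≰n  = ⊥-elim (ℚ.<-irrefl refl (ℚ.<-≤-trans (ι-mono-< (≰⇒> m≰n)) le))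

ι-cancel-< : ∀ {m n} → ι m ℚ.< ι n → m < n
ι-cancel-< {m} {n} lt with m <? n
... | yes m<n = m<n
... | no m≮n  = ⊥-elim (ℚ.<-irrefl refl (ℚ.<-≤-trans lt (ι-mono-≤ (≮⇒≥ m≮n))))

ι-injective : ∀ {m n} → ι m ≡ ι n → m ≡ n
ι-injective eq = ≤-antisym (ι-cancel-≤ (ℚ.≤-reflexive eq)) (ι-cancel-≤ (ℚ.≤-reflexive (sym eq)))

-- Numbering the integers and the open unit intervals from left to right in one sequence turns the
-- geometry of rational points into comparisons of natural numbers.
data Cell (p : ℚ) : ℕ → Set where
  point : ∀ n → p ≡ ι n → Cell p (2 * n)
  gap   : ∀ n → ι n ℚ.< p → p ℚ.< ι (suc n) → Cell p (suc (2 * n))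

cell : ∀ {p} n → ι 0 ℚ.≤ p → p ℚ.≤ ι n → ∃ (Cell p)
cell     zero    0≤p p≤0   = _ , point 0 (ℚ.≤-antisym p≤0 0≤p)
cell {p} (suc n) 0≤p p≤1+n with ℚ.<-cmp p (ι n)
... | tri< p<n _ _ = cell n 0≤p (ℚ.<⇒≤ p<n)
... | tri≈ _ p≡n _ = _ , point n p≡n
... | tri> _ _ n<p with ℚ.<-cmp p (ι (suc n))
...   | tri< p<1+n _ _ = _ , gap n n<p p<1+n
...   | tri≈ _ p≡1+n _ = _ , point (suc n) p≡1+n
...   | tri> _ _ 1+n<p = ⊥-elim (ℚ.<-irrefl refl (ℚ.<-≤-trans 1+n<p p≤1+n))

cell-lower : ∀ {p a n} → Cell p a → ι n ℚ.≤ p → 2 * n ≤ a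
cell-lower (point k refl)   n≤p = *-monoʳ-≤ 2 (ι-cancel-≤ n≤p)
cell-lower (gap k _ p<1+k)  n≤p = m≤n⇒m≤1+n (*-monoʳ-≤ 2 (ℕ.s≤s⁻¹ (ι-cancel-< (ℚ.≤-<-trans n≤p p<1+k))))

cell-upper : ∀ {p a n} → Cell p a → p ℚ.≤ ι n → a ≤ 2 * n
cell-upper         (point k refl) p≤n = *-monoʳ-≤ 2 (ι-cancel-≤ p≤n)
cell-upper {n = n} (gap k k<p _)  p≤n = <⇒≤ (≤-trans (≤-reflexive (sym (*-suc 2 k)))
  (*-monoʳ-≤ 2 (ι-cancel-< (ℚ.<-≤-trans k<p p≤n))))

cell-even : ∀ {p a n} → Cell p a → a ≡ 2 * n → p ≡ ι n
cell-even {n = n} (point k p≡k) eq = trans p≡k (cong ι (*-cancelˡ-≡ k n 2 eq))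
cell-even {n = n} (gap k _ _)   eq = ⊥-elim (even≢odd n k (sym eq))

cell-unique : ∀ {p a b} → Cell p a → Cell p b → a ≡ b
cell-unique (point k p≡k) (point l p≡l) = cong (2 *_) (ι-injective (trans (sym p≡k) p≡l))
cell-unique (point k refl) (gap l l<p p<1+l) = ⊥-elim (<⇒≱ (ι-cancel-< l<p) (ℕ.s≤s⁻¹ (ι-cancel-< p<1+l)))
cell-unique (gap k k<p p<1+k) (point l refl) = ⊥-elim (<⇒≱ (ι-cancel-< k<p) (ℕ.s≤s⁻¹ (ι-cancel-< p<1+k)))
cell-unique (gap k k<p p<1+k) (gap l l<p p<1+l) = cong (λ n → ℕ.suc (2 * n)) (≤-antisym
  (ℕ.s≤s⁻¹ (ι-cancel-< (ℚ.<-trans k<p p<1+l))) (ℕ.s≤s⁻¹ (ι-cancel-< (ℚ.<-trans l<p p<1+k))))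

module _ {t} (0≤t : 0ℚ ℚ.≤ t) (t≤1 : t ℚ.≤ 1ℚ) where
  private
    instance
      t-nonNegative : ℚ.NonNegative t
      t-nonNegative = ℚ.nonNegative 0≤t

      1-t-nonNegative : ℚ.NonNegative (1ℚ ℚ.- t)
      1-t-nonNegative = ℚ.nonNegative (subst (ℚ._≤ 1ℚ ℚ.- t) (ℚ.+-inverseʳ t) (ℚ.+-monoˡ-≤ (ℚ.- t) t≤1))

    constant : ∀ p → (1ℚ ℚ.- t) ℚ.* p ℚ.+ t ℚ.* p ≡ p
    constant p = ℚ-Solver.solve 2 (λ t p → (con 1ℚ :- t) :* p :+ t :* p := p) refl t p
      where open ℚ-Solver

  convex-lower : ∀ {l p q} → l ℚ.≤ p → l ℚ.≤ q → l ℚ.≤ (1ℚ ℚ.- t) ℚ.* p ℚ.+ t ℚ.* q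
  convex-lower {l} l≤p l≤q = subst (ℚ._≤ _) (constant l)
    (ℚ.+-mono-≤ (ℚ.*-monoˡ-≤-nonNeg (1ℚ ℚ.- t) l≤p) (ℚ.*-monoˡ-≤-nonNeg t l≤q))

  convex-upper : ∀ {u p q} → p ℚ.≤ u → q ℚ.≤ u → (1ℚ ℚ.- t) ℚ.* p ℚ.+ t ℚ.* q ℚ.≤ u
  convex-upper {u} p≤u q≤u = subst (_ ℚ.≤_) (constant u)
    (ℚ.+-mono-≤ (ℚ.*-monoˡ-≤-nonNeg (1ℚ ℚ.- t) p≤u) (ℚ.*-monoˡ-≤-nonNeg t q≤u))

infix 5 _,,_
_,,_ : ℕ → ℕ → Point
x ,, y = ι x , ι y

grid-injective : ∀ {x y x′ y′} → x ,, y ≡ x′ ,, y′ → x ≡ x′ × y ≡ y′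
grid-injective eq = ι-injective (cong proj₁ eq) , ι-injective (cong proj₂ eq)

record InBox (x₁ x₂ y₁ y₂ : ℕ) (p : Point) : Set where
  constructor box
  field
    left  : ι x₁ ℚ.≤ proj₁ p
    right : proj₁ p ℚ.≤ ι x₂
    floor : ι y₁ ℚ.≤ proj₂ p
    roof  : proj₂ p ℚ.≤ ι y₂

-- The edges are drawn with horizontal and vertical segments, and the bounding box of such a segment
-- is degenerate, so passing to boxes loses nothing.
segment⊆box : ∀ {x₁ x₂ y₁ y₂ x y x′ y′ p} →
  x₁ ≤ x → x ≤ x₂ → x₁ ≤ x′ → x′ ≤ x₂ → y₁ ≤ y → y ≤ y₂ → y₁ ≤ y′ → y′ ≤ y₂ →
  OnSegment (x ,, y) (x′ ,, y′) p → InBox x₁ x₂ y₁ y₂ p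
segment⊆box a b c d e f g h (t , 0≤t , t≤1 , refl) = box
  (convex-lower 0≤t t≤1 (ι-mono-≤ a) (ι-mono-≤ c)) (convex-upper 0≤t t≤1 (ι-mono-≤ b) (ι-mono-≤ d))
  (convex-lower 0≤t t≤1 (ι-mono-≤ e) (ι-mono-≤ g)) (convex-upper 0≤t t≤1 (ι-mono-≤ f) (ι-mono-≤ h))

horizontal⊆box : ∀ {x x′ y p} → x ≤ x′ → OnSegment (x ,, y) (x′ ,, y) p → InBox x x′ y y p
horizontal⊆box le = segment⊆box ≤-refl le le ≤-refl ≤-refl ≤-refl ≤-refl ≤-refl

vertical⊆box : ∀ {x y y′ p} → y ≤ y′ → OnSegment (x ,, y) (x ,, y′) p → InBox x x y y′ p
vertical⊆box le = segment⊆box ≤-refl ≤-refl ≤-refl ≤-refl ≤-refl le le ≤-refl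

horizontal⊆box′ : ∀ {x x′ y p} → x ≤ x′ → OnSegment (x′ ,, y) (x ,, y) p → InBox x x′ y y p
horizontal⊆box′ le = segment⊆box le ≤-refl ≤-refl le ≤-refl ≤-refl ≤-refl ≤-refl

vertical⊆box′ : ∀ {x y y′ p} → y ≤ y′ → OnSegment (x ,, y′) (x ,, y) p → InBox x x y y′ p
vertical⊆box′ le = segment⊆box ≤-refl ≤-refl ≤-refl ≤-refl le ≤-refl ≤-refl le

-- The graph

quotient-unique : ∀ d {q q′ a} → d * q ≤ a → a < d * suc q → d * q′ ≤ a → a < d * suc q′ → q ≡ q′
quotient-unique d {q} {q′} l u l′ u′ with <-cmp q q′
... | tri≈ _ eq _ = eq
... | tri< q<q′ _ _ = ⊥-elim (<⇒≱ u  (≤-trans (*-monoʳ-≤ d q<q′) l′))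
... | tri> _ _ q′<q = ⊥-elim (<⇒≱ u′ (≤-trans (*-monoʳ-≤ d q′<q) l))

digit-bounds : ∀ d q {r} → r < d → d * q ≤ d * q + r × d * q + r < d * suc q
digit-bounds d q {r} r<d = m≤m+n _ r , (begin-strict
  d * q + r <⟨ +-monoʳ-< (d * q) r<d ⟩
  d * q + d ≡⟨ +-comm (d * q) d ⟩
  d + d * q ≡⟨ *-suc d q ⟨
  d * suc q ∎)
  where open ≤-Reasoning

digits-unique : ∀ d {q q′ r r′} → r < d → r′ < d → d * q + r ≡ d * q′ + r′ → q ≡ q′ × r ≡ r′
digits-unique d {q} {q′} {r} {r′} r<d r′<d eq
  with quotient-unique d {q} {q′} (proj₁ (digit-bounds d q r<d)) (proj₂ (digit-bounds d q r<d))
         (subst (d * q′ ≤_) (sym eq) (proj₁ (digit-bounds d q′ r′<d)))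
         (subst (_< d * suc q′) (sym eq) (proj₂ (digit-bounds d q′ r′<d)))
... | refl = refl , +-cancelˡ-≡ (d * q) r r′ eq

module Wall (n K : ℕ) (0<n : 0 < n) (2≤K : 2 ≤ K) where

  -- A spine has `m` vertices, and `w` is the last abscissa of both rows, one spacing `K` beyond the
  -- last of the `3 * m` columns.
  m w : ℕ
  m = suc n
  w = K * suc (3 * m)

  abstract
    -- Up to the successor, gadget and position are the digits of the column number in base `m`. The
    -- successor keeps abscissa 0 free of columns, as the edge `return` starts there.
    col : Fin 3 → ℕ → ℕ
    col s t = suc (m * toℕ s + t)

    col-def : ∀ s t → col s t ≡ suc (m * toℕ s + t)
    col-def s t = refl

  X : Fin 3 → ℕ → ℕ
  X s t = K * col s t

  instance
    K-nonZero : NonZero K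
    K-nonZero = ℕ.>-nonZero (≤-trans (s≤s z≤n) 2≤K)

  abstract
    col-suc : ∀ s t → col s (suc t) ≡ suc (col s t)
    col-suc s t = cong suc (+-suc _ t)

    col-injective : ∀ {s s′ t t′} → t ≤ n → t′ ≤ n → col s t ≡ col s′ t′ → s ≡ s′ × t ≡ t′
    col-injective t≤n t′≤n eq with digits-unique m (s≤s t≤n) (s≤s t′≤n) (suc-injective eq)
    ... | s≡s′ , t≡t′ = toℕ-injective s≡s′ , t≡t′

    col≤3m : ∀ s {t} → t ≤ n → col s t ≤ 3 * m
    col≤3m s {t} t≤n = begin
      suc (m * toℕ s + t) ≤⟨ proj₂ (digit-bounds m (toℕ s) (s≤s t≤n)) ⟩
      m * suc (toℕ s)     ≤⟨ *-monoʳ-≤ m (toℕ<n s) ⟩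
      m * 3               ≡⟨ *-comm m 3 ⟩
      3 * m               ∎
      where open ≤-Reasoning

    col-mono-digit : ∀ {s s′} t {t′} → t ≤ n → toℕ s < toℕ s′ → col s t < col s′ t′
    col-mono-digit {s} {s′} t t≤n s<s′ = s≤s (≤-trans (proj₂ (digit-bounds m (toℕ s) (s≤s t≤n)))
      (≤-trans (*-monoʳ-≤ m s<s′) (m≤m+n _ _)))

    0<col : ∀ s t → 0 < col s t
    0<col s t = s≤s z≤n

    col-mono-≤ : ∀ s {t t′} → t ≤ t′ → col s t ≤ col s t′
    col-mono-≤ s t≤t′ = s≤s (+-monoʳ-≤ (m * toℕ s) t≤t′)

  X-injective : ∀ {s s′ t t′} → t ≤ n → t′ ≤ n → X s t ≡ X s′ t′ → s ≡ s′ × t ≡ t′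
  X-injective {s} {s′} {t} {t′} t≤n t′≤n eq = col-injective {s} {s′} t≤n t′≤n (*-cancelˡ-≡ (col s t) (col s′ t′) K eq)

  X<w : ∀ s {t} → t ≤ n → X s t < w
  X<w s t≤n = *-monoʳ-< K (s≤s (col≤3m s t≤n))

  K≤X : ∀ s t → K ≤ X s t
  K≤X s t = m≤m*n K (col s t) {{ℕ.>-nonZero (0<col s t)}}

  X-mono-≤ : ∀ s {t t′} → t ≤ t′ → X s t ≤ X s t′
  X-mono-≤ s t≤t′ = *-monoʳ-≤ K (col-mono-≤ s t≤t′)

  X-mono-< : ∀ s {t t′} → t < t′ → X s t < X s t′
  X-mono-< s {t} t<t′ = *-monoʳ-< K (subst (_≤ _) (col-suc s t) (col-mono-≤ s t<t′))

  off-column : ∀ {s s′ t t′ e} → 0 < e → e < K → X s t + e ≢ X s′ t′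
  off-column {s} {s′} {t} {t′} {e} 0<e e<K eq = <⇒≢ 0<e (sym (proj₂
    (digits-unique K {col s t} {col s′ t′} e<K (≤-trans (s≤s z≤n) 2≤K) (trans eq (sym (+-identityʳ _))))))

  not-adjacent-columns : ∀ {s s′ t t′} → suc (X s t) ≢ X s′ t′
  not-adjacent-columns eq = off-column (s≤s z≤n) 2≤K (trans (+-comm _ 1) eq)

  -- D and T are the rows at heights 1 and 3 of the drawing; S s t is the t-th vertex of the
  -- spine of gadget s, at height 2 and abscissa X s t.  The cycle of gadget s consists of its
  -- spine, the vertices of T above the two ends of the spine, and the closer joining these.
  data Site : Set where
    D : ℕ → Site
    S : Fin 3 → ℕ → Site
    T : ℕ → Site

  Valid : Site → Set
  Valid (D x)   = x ≤ w
  Valid (S s t) = t ≤ n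
  Valid (T x)   = x ≤ w

  -- Numbering of the vertices

  order : ℕ
  order = suc w + (3 * m + suc w)

  private
    onSpine : Fin 3 × Fin m → Site
    onSpine (s , t) = S s (toℕ t)

    decode₂ : Fin (3 * m) ⊎ Fin (suc w) → Site
    decode₂ (inj₁ i) = onSpine (remQuot m i)
    decode₂ (inj₂ x) = T (toℕ x)

    decode : Fin (suc w) ⊎ Fin (3 * m + suc w) → Site
    decode (inj₁ x) = D (toℕ x)
    decode (inj₂ u) = decode₂ (splitAt (3 * m) u)

  -- The number of the vertex at a site. All links ascend in it, so no vertex is linked to itself
  -- and an edge from a smaller to a larger vertex is drawn in the direction of its link.
  code : Site → ℕ
  code (D x)   = x
  code (S s t) = suc w + (m * toℕ s + t)
  code (T x)   = suc w + (3 * m + x)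

  abstract
    site : Fin order → Site
    site u = decode (splitAt (suc w) u)

    place : ∀ σ → Valid σ → Fin order
    place (D x)   x≤w = fromℕ< (s≤s x≤w) ↑ˡ _
    place (S s t) t≤n = suc w ↑ʳ (combine s (fromℕ< (s≤s t≤n)) ↑ˡ _)
    place (T x)   x≤w = suc w ↑ʳ (3 * m ↑ʳ fromℕ< (s≤s x≤w))

    site-place : ∀ σ (v : Valid σ) → site (place σ v) ≡ σ
    site-place (D x) x≤w
      rewrite splitAt-↑ˡ (suc w) (fromℕ< (s≤s x≤w)) (3 * m + suc w) = cong D (toℕ-fromℕ< (s≤s x≤w))
    site-place (S s t) t≤n
      rewrite splitAt-↑ʳ (suc w) (3 * m + suc w) (combine s (fromℕ< (s≤s t≤n)) ↑ˡ suc w)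
            | splitAt-↑ˡ (3 * m) (combine s (fromℕ< (s≤s t≤n))) (suc w)
      = trans (cong onSpine (remQuot-combine s (fromℕ< (s≤s t≤n)))) (cong (S s) (toℕ-fromℕ< (s≤s t≤n)))
    site-place (T x) x≤w
      rewrite splitAt-↑ʳ (suc w) (3 * m + suc w) (3 * m ↑ʳ fromℕ< (s≤s x≤w))
            | splitAt-↑ʳ (3 * m) (suc w) (fromℕ< (s≤s x≤w)) = cong T (toℕ-fromℕ< (s≤s x≤w))

    site-valid : ∀ u → Valid (site u)
    site-valid u with splitAt (suc w) u
    ... | inj₁ x = ℕ.s≤s⁻¹ (toℕ<n x)
    ... | inj₂ v with splitAt (3 * m) v
    ...   | inj₁ i = ℕ.s≤s⁻¹ (toℕ<n (proj₂ (remQuot {3} m i)))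
    ...   | inj₂ x = ℕ.s≤s⁻¹ (toℕ<n x)

    toℕ≡code : ∀ u → toℕ u ≡ code (site u)
    toℕ≡code u = trans (cong toℕ (sym (join-splitAt (suc w) (3 * m + suc w) u))) (outer (splitAt (suc w) u))
      where
      inner : ∀ v → suc w + toℕ (join (3 * m) (suc w) v) ≡ code (decode₂ v)
      inner (inj₁ i) = cong (suc w +_) (trans (toℕ-↑ˡ i _)
        (trans (cong toℕ (sym (combine-remQuot {3} m i))) (toℕ-combine (proj₁ (remQuot {3} m i)) (proj₂ (remQuot {3} m i)))))
      inner (inj₂ x) = cong (suc w +_) (toℕ-↑ʳ (3 * m) x)
      outer : ∀ v → toℕ (join (suc w) (3 * m + suc w) v) ≡ code (decode v)
      outer (inj₁ x) = toℕ-↑ˡ x _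
      outer (inj₂ v) = trans (toℕ-↑ʳ (suc w) v)
        (trans (cong (λ v → suc w + toℕ v) (sym (join-splitAt (3 * m) (suc w) v))) (inner (splitAt (3 * m) v)))

  site-injective : Injective _≡_ _≡_ site
  site-injective {u} {v} eq = toℕ-injective (trans (toℕ≡code u) (trans (cong code eq) (sym (toℕ≡code v))))

  -- Each spine vertex is attached to both rows, which will fix its sign. `closer` is the edge
  -- between equal lists on the odd cycle of a gadget, and `return` carries the sign of list A from
  -- the start of row D to the end of row T.
  data Link : Site → Site → Set where
    rowD   : ∀ {x} → Link (D x) (D (suc x))
    rowT   : ∀ {x} → Link (T x) (T (suc x))
    spine  : ∀ {s t} → Link (S s t) (S s (suc t))
    down   : ∀ {s t x} → x ≡ X s t → Link (D x) (S s t)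
    up     : ∀ {s t x} → x ≡ X s t → Link (S s t) (T x)
    closer : ∀ {s x y} → x ≡ X s 0 → y ≡ X s n → Link (T x) (T y)
    return : ∀ {x} → x ≡ w → Link (D 0) (T x)

  link? : ∀ σ τ → Dec (Link σ τ)
  link? (D x) (D y) = map′ (λ { refl → rowD }) (λ { rowD → refl }) (y ≟ suc x)
  link? (D x) (S s t) = map′ down (λ { (down eq) → eq }) (x ≟ X s t)
  link? (D zero) (T y) = map′ return (λ { (return eq) → eq }) (y ≟ w)
  link? (D (suc x)) (T y) = no λ ()
  link? (S s t) (D x) = no λ ()
  link? (S s t) (S s′ t′) = map′ (λ { (refl , refl) → spine }) (λ { spine → refl , refl })
    (s′ Fin.≟ s ×-dec t′ ≟ suc t)
  link? (S s t) (T x) = map′ up (λ { (up eq) → eq }) (x ≟ X s t)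
  link? (T x) (D y) = no λ ()
  link? (T x) (S s t) = no λ ()
  link? (T x) (T y) = map′ (λ { (inj₁ refl) → rowT ; (inj₂ (s , eq , eq′)) → closer eq eq′ })
    (λ { rowT → inj₁ refl ; (closer eq eq′) → inj₂ (_ , eq , eq′) })
    (y ≟ suc x ⊎-dec any? λ s → x ≟ X s 0 ×-dec y ≟ X s n)

  link-code : ∀ {σ τ} → Valid σ → Valid τ → Link σ τ → code σ < code τ
  link-code _ _ rowD = ≤-refl
  link-code _ _ rowT = +-monoʳ-< (suc w) (+-monoʳ-< (3 * m) ≤-refl)
  link-code _ _ (spine {s}) = +-monoʳ-< (suc w) (+-monoʳ-< (m * toℕ s) ≤-refl)
  link-code x≤w _ (down _) = ≤-trans (s≤s x≤w) (m≤m+n _ _)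
  link-code t≤n _ (up {s} _) = +-monoʳ-< (suc w) (≤-trans (subst (_≤ 3 * m) (col-def s _) (col≤3m s t≤n)) (m≤m+n _ _))
  link-code _ _ (closer {s} refl refl) = +-monoʳ-< (suc w) (+-monoʳ-< (3 * m) (X-mono-< s 0<n))
  link-code _ _ (return _) = s≤s z≤n

  graph : Graph
  graph = record
    { order    = order
    ; _~_      = λ u v → Link (site u) (site v) ⊎ Link (site v) (site u)
    ; ~-sym    = swap
    ; ~-irrefl = λ { {u} refl (inj₁ l) → irrefl u l ; {u} refl (inj₂ l) → irrefl u l }
    ; _~?_     = λ u v → link? (site u) (site v) ⊎-dec link? (site v) (site u)
    }
    where
    irrefl : ∀ u → ¬ Link (site u) (site u)
    irrefl u l = <-irrefl refl (link-code (site-valid u) (site-valid u) l)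

  open Graph graph using (Vertex; _~_; ~-sym)

  -- A degeneracy order

  Left Right : ℕ → Set
  Left  x = ∃ λ s → x ≡ X s 0
  Right x = ∃ λ s → x ≡ X s n

  data Corner? (x : ℕ) : Set where
    left  : ∀ s → x ≡ X s 0 → Corner? x
    right : ∀ s → x ≡ X s n → Corner? x
    inner : ¬ Left x → ¬ Right x → Corner? x

  corner? : ∀ x → Corner? x
  corner? x with any? (λ s → x ≟ X s 0) | any? (λ s → x ≟ X s n)
  ... | yes (s , eq) | _            = left s eq
  ... | no _         | yes (s , eq) = right s eq
  ... | no ¬l        | no ¬r        = inner ¬l ¬r

  Left⇒¬Right : ∀ {x} → Left x → ¬ Right x
  Left⇒¬Right (s , eq) (s′ , eq′) = <⇒≢ 0<n (proj₂ (X-injective {s} {s′} z≤n ≤-refl (trans (sym eq) eq′)))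

  rankT : ∀ {x} → Corner? x → ℕ
  rankT (left _ _)      = 0
  rankT (right _ _)     = 2 + n
  rankT {x} (inner _ _) = 3 + n + x

  -- The order of construction: left corners, spines from left to right, right corners, the rest of
  -- row T from left to right, finally row D from left to right.
  rank : Site → ℕ
  rank (D x)   = 4 + n + w + x
  rank (S s t) = suc t
  rank (T x)   = rankT (corner? x)

  rank-right : ∀ {x} → Right x → rank (T x) ≡ 2 + n
  rank-right {x} r with corner? x
  ... | left s eq  = ⊥-elim (Left⇒¬Right (s , eq) r)
  ... | right _ _  = refl
  ... | inner _ ¬r = ⊥-elim (¬r r)

  rankT<rankD : ∀ {x y} → x ≤ w → rank (T x) < rank (D y)
  rankT<rankD {x} {y} x≤w with corner? x
  ... | left _ _  = s≤s z≤n
  ... | right _ _ = s≤s (s≤s (s≤s (≤-trans (m≤m+n n w) (≤-trans (n≤1+n _) (s≤s (m≤m+n _ y))))))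
  ... | inner _ _ = s≤s (s≤s (s≤s (s≤s (≤-trans (+-monoʳ-≤ n x≤w) (m≤m+n _ y)))))

  rankS<rankD : ∀ {s t y} → t ≤ n → rank (S s t) < rank (D y)
  rankS<rankD {y = y} t≤n =
    s≤s (s≤s (≤-trans t≤n (≤-trans (m≤m+n n (w + y)) (≤-trans (≤-reflexive (sym (+-assoc n w y))) (≤-trans (n≤1+n _) (n≤1+n _))))))

  -- The lower neighbours of a vertex are sorted into two types with at most one of each. Where both
  -- types occur, `Main` is the neighbour that continues a long path, and `Side` is the other one.
  data Main : Site → Site → Set where
    rowD  : ∀ {x} → Main (D x) (D (suc x))
    spine : ∀ {s t} → Main (S s t) (S s (suc t))
    side  : ∀ {s x} → x ≡ X s n → Main (S s n) (T x)
    rowT  : ∀ {x} → ¬ Left (suc x) → ¬ Right (suc x) → Main (T x) (T (suc x))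

  data Side : Site → Site → Set where
    down   : ∀ {s t x} → x ≡ X s t → Side (S s t) (D x)
    return : ∀ {x} → x ≡ w → Side (T x) (D 0)
    side   : ∀ {s x} → x ≡ X s 0 → Side (T x) (S s 0)
    closer : ∀ {s x y} → x ≡ X s 0 → y ≡ X s n → Side (T x) (T y)
    up     : ∀ {s t x} → ¬ Left x → ¬ Right x → x ≡ X s t → Side (S s t) (T x)
    rowT   : ∀ {x} → ¬ Left x → ¬ Right x → Left (suc x) ⊎ Right (suc x) → Side (T (suc x)) (T x)

  main-unique : ∀ {σ σ′ τ} → Main σ τ → Main σ′ τ → σ ≡ σ′
  main-unique rowD       rowD        = refl
  main-unique spine      spine       = refl
  main-unique (side {s} eq)  (side {s′} eq′)  with X-injective {s} {s′} ≤-refl ≤-refl (trans (sym eq) eq′)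
  ... | refl , _ = refl
  main-unique (side eq)  (rowT _ ¬r) = ⊥-elim (¬r (_ , eq))
  main-unique (rowT _ ¬r) (side eq)  = ⊥-elim (¬r (_ , eq))
  main-unique (rowT _ _) (rowT _ _)  = refl

  side-unique : ∀ {σ σ′ τ} → Valid σ → Valid σ′ → Side σ τ → Side σ′ τ → σ ≡ σ′
  side-unique v v′ (down {s} {t} eq) (down {s′} {t′} eq′) with X-injective {s} {s′} v v′ (trans (sym eq) eq′)
  ... | refl , refl = refl
  side-unique _ _ (down {s} {t} eq) (return _) = contradiction (subst (2 ≤_) (sym eq) (≤-trans 2≤K (K≤X s t))) λ ()
  side-unique _ _ (return _) (down {s} {t} eq) = contradiction (subst (2 ≤_) (sym eq) (≤-trans 2≤K (K≤X s t))) λ ()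
  side-unique _ _ (return refl) (return refl) = refl
  side-unique _ _ (side refl) (side refl) = refl
  side-unique _ _ (closer {s} refl eq) (closer {s′} refl eq′) with X-injective {s} {s′} ≤-refl ≤-refl (trans (sym eq) eq′)
  ... | refl , _ = refl
  side-unique _ _ (closer _ eq) (up _ ¬r _) = ⊥-elim (¬r (_ , eq))
  side-unique _ _ (closer _ eq) (rowT _ ¬r _) = ⊥-elim (¬r (_ , eq))
  side-unique _ _ (up _ ¬r _) (closer _ eq) = ⊥-elim (¬r (_ , eq))
  side-unique _ _ (rowT _ ¬r _) (closer _ eq) = ⊥-elim (¬r (_ , eq))
  side-unique v v′ (up {s} _ _ eq) (up {s′} _ _ eq′) with X-injective {s} {s′} v v′ (trans (sym eq) eq′)
  ... | refl , refl = refl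
  side-unique _ _ (up {s} {t} _ _ refl) (rowT _ _ (inj₁ (s′ , eq))) = ⊥-elim (not-adjacent-columns {s} {s′} {t} {0} eq)
  side-unique _ _ (up {s} {t} _ _ refl) (rowT _ _ (inj₂ (s′ , eq))) = ⊥-elim (not-adjacent-columns {s} {s′} {t} {n} eq)
  side-unique _ _ (rowT _ _ (inj₁ (s′ , eq))) (up {s} {t} _ _ refl) = ⊥-elim (not-adjacent-columns {s} {s′} {t} {0} eq)
  side-unique _ _ (rowT _ _ (inj₂ (s′ , eq))) (up {s} {t} _ _ refl) = ⊥-elim (not-adjacent-columns {s} {s′} {t} {n} eq)
  side-unique _ _ (rowT _ _ _) (rowT _ _ _) = refl

  Below : Site → Site → Set
  Below σ τ = Main σ τ ⊎ Side σ τ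

  -- The rank falls along links that leave row D for another level, along links of row T that enter
  -- a corner from the left, and from the first spine vertex up to the left corner. Two corners are
  -- never consecutive in row T because columns are spaced by `K`.
  directed : ∀ {σ τ} → Valid σ → Valid τ → Link σ τ →
    (rank σ < rank τ × Below σ τ) ⊎ (rank τ < rank σ × Below τ σ)
  directed _ _ rowD = inj₁ (+-monoʳ-< (4 + n + w) ≤-refl , inj₁ rowD)
  directed _ _ (rowT {x}) with corner? x | corner? (suc x)
  ... | left _ _  | inner ¬l ¬r = inj₁ (s≤s z≤n , inj₁ (rowT ¬l ¬r))
  ... | right _ _ | inner ¬l ¬r = inj₁ (m≤m+n _ _ , inj₁ (rowT ¬l ¬r))
  ... | inner _ _ | inner ¬l ¬r = inj₁ (+-monoʳ-< (3 + n) ≤-refl , inj₁ (rowT ¬l ¬r))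
  ... | inner ¬l ¬r | left s eq = inj₂ (s≤s z≤n , inj₂ (rowT ¬l ¬r (inj₁ (s , eq))))
  ... | inner ¬l ¬r | right s eq = inj₂ (m≤m+n _ _ , inj₂ (rowT ¬l ¬r (inj₂ (s , eq))))
  ... | left s refl | left s′ eq = ⊥-elim (not-adjacent-columns {s} {s′} {0} {0} eq)
  ... | left s refl | right s′ eq = ⊥-elim (not-adjacent-columns {s} {s′} {0} {n} eq)
  ... | right s refl | left s′ eq = ⊥-elim (not-adjacent-columns {s} {s′} {n} {0} eq)
  ... | right s refl | right s′ eq = ⊥-elim (not-adjacent-columns {s} {s′} {n} {n} eq)
  directed _ _ spine = inj₁ (≤-refl , inj₁ spine)
  directed _ t≤n (down {s} {t} eq) = inj₂ (rankS<rankD {s} {t} t≤n , inj₂ (down eq))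
  directed t≤n _ (up {s} {t} {x} eq) with corner? x
  ... | left s′ eq′ with X-injective {s} {s′} t≤n z≤n (trans (sym eq) eq′)
  ...   | refl , refl = inj₂ (s≤s z≤n , inj₂ (side eq))
  directed t≤n _ (up {s} {t} {x} eq) | right s′ eq′ with X-injective {s} {s′} t≤n ≤-refl (trans (sym eq) eq′)
  ...   | refl , refl = inj₁ (≤-refl , inj₁ (side eq))
  directed t≤n _ (up {s} {t} {x} eq) | inner ¬l ¬r = inj₁ (s≤s (s≤s (≤-trans t≤n (≤-trans (m≤m+n n x) (n≤1+n _)))) , inj₂ (up ¬l ¬r eq))
  directed _ _ (closer {s} {x} {y} eq eq′) = inj₁
    (subst₂ _<_ (sym (rank-left (s , eq))) (sym (rank-right (s , eq′))) (s≤s z≤n) , inj₂ (closer eq eq′))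
    where
    rank-left : ∀ {x} → Left x → rank (T x) ≡ 0
    rank-left {x} l with corner? x
    ... | left _ _   = refl
    ... | right s eq = ⊥-elim (Left⇒¬Right l (s , eq))
    ... | inner ¬l _ = ⊥-elim (¬l l)
  directed _ x≤w (return refl) = inj₂ (rankT<rankD x≤w , inj₂ (return refl))

  module _ {u v : Vertex} where
    lower⇒Below : u ~ v → rank (site u) < rank (site v) → Below (site u) (site v)
    lower⇒Below (inj₁ l) u<v with directed (site-valid u) (site-valid v) l
    ... | inj₁ (_ , below) = below
    ... | inj₂ (v<u , _)   = ⊥-elim (<-asym u<v v<u)
    lower⇒Below (inj₂ l) u<v with directed (site-valid v) (site-valid u) l
    ... | inj₁ (v<u , _)   = ⊥-elim (<-asym u<v v<u)
    ... | inj₂ (_ , below) = below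

    rank-proper : u ~ v → rank (site u) ≢ rank (site v)
    rank-proper (inj₁ l) with directed (site-valid u) (site-valid v) l
    ... | inj₁ (lt , _) = <⇒≢ lt
    ... | inj₂ (gt , _) = >⇒≢ gt
    rank-proper (inj₂ l) with directed (site-valid v) (site-valid u) l
    ... | inj₁ (gt , _) = >⇒≢ gt
    ... | inj₂ (lt , _) = <⇒≢ lt

  packable : AllPackable graph 4
  packable = 2-degenerate⇒4-packable graph (rank ∘ site) rank-proper λ a<v b<v c<v →
    pigeonhole (below a<v) (below b<v) (below c<v)
    where
    below : ∀ {u v} → u ~ v × rank (site u) < rank (site v) → Below (site u) (site v)
    below (u~v , u<v) = lower⇒Below u~v u<v

    mains : ∀ {a b τ} → Main (site a) τ → Main (site b) τ → a ≡ b
    mains p q = site-injective (main-unique p q)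

    sides : ∀ {a b τ} → Side (site a) τ → Side (site b) τ → a ≡ b
    sides {a} {b} p q = site-injective (side-unique (site-valid a) (site-valid b) p q)

    pigeonhole : ∀ {a b c τ} → Below (site a) τ → Below (site b) τ → Below (site c) τ → a ≡ b ⊎ a ≡ c ⊎ b ≡ c
    pigeonhole (inj₁ p) (inj₁ q) _        = inj₁ (mains p q)
    pigeonhole (inj₂ p) (inj₂ q) _        = inj₁ (sides p q)
    pigeonhole (inj₁ p) (inj₂ _) (inj₁ r) = inj₂ (inj₁ (mains p r))
    pigeonhole (inj₂ p) (inj₁ _) (inj₂ r) = inj₂ (inj₁ (sides p r))
    pigeonhole (inj₁ _) (inj₂ q) (inj₂ r) = inj₂ (inj₂ (sides q r))
    pigeonhole (inj₂ _) (inj₁ q) (inj₁ r) = inj₂ (inj₂ (mains q r))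

  -- Girth of the graph

  pred-∸ : ∀ {x y j} → y + suc j ≡ x → x ∸ j ≡ suc y
  pred-∸ {y = y} {j} refl = trans (cong (_∸ j) (+-suc y j)) (m+n∸n≡m (suc y) j)

  ∸-suc-pred : ∀ x j {y} → suc y ≡ x ∸ suc j → y ≡ x ∸ (2 + j)
  ∸-suc-pred x j {y} eq = trans (cong (_∸ 1) eq) (trans (∸-+-assoc x (suc j) 1) (cong (x ∸_) (+-comm (suc j) 1)))

  ∸-fresh : ∀ {x} → x ≢ 0 → ∀ j → x ∸ suc j ≢ x
  ∸-fresh {zero}  x≢0 _ _  = x≢0 refl
  ∸-fresh {suc x} _   j eq = 1+n≰n (≤-trans (≤-reflexive (sym eq)) (m∸n≤m x j))

  -- The dense rows have no further edges in between two columns, so a cycle that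
  -- tops out at a column of such a row contains K of its vertices.
  module _ {g} (g≤K : g ≤ K) {x e s t} (x+e : x + e ≡ X s t) (e≤1 : e ≤ 1) where

    -- The start `x` is a column for `e` equal to 0 and lies just left of one for `e` equal to 1.
    -- The distance `suc j + e` to that column stays below `K`, so no other column is met, and
    -- neither is abscissa 0, since the first column is at `K`.
    between : ∀ j → 2 + j < g → x ∸ suc j + suc j ≡ x × (∀ s′ t′ → x ∸ suc j ≢ X s′ t′) × 0 < x ∸ suc j
    between j lt = sum , (λ s′ t′ eq → off-column {s′} {s} {t′} {t} {suc j + e} (s≤s z≤n) j+e<K (trans (cong (_+ (suc j + e)) (sym eq))
        (trans (sym (+-assoc (x ∸ suc j) (suc j) e)) (trans (cong (_+ e) sum) x+e))))
      , m<n⇒0<n∸m 1+j<x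
      where
      j+e<K : suc j + e < K
      j+e<K = ≤-trans (s≤s (+-monoʳ-≤ (suc j) e≤1)) (≤-trans (≤-reflexive (cong (2 +_) (+-comm j 1))) (≤-trans lt g≤K))
      1+j<x : suc j < x
      1+j<x = +-cancelʳ-< e (suc j) x (≤-trans j+e<K (≤-trans (K≤X s t) (≤-reflexive (sym x+e))))
      sum : x ∸ suc j + suc j ≡ x
      sum = m∸n+n≡m (<⇒≤ 1+j<x)

    x≢0 : x ≢ 0
    x≢0 eq = <⇒≱ (≤-trans 2≤K (K≤X s t))
      (≤-trans (≤-reflexive (trans (sym x+e) (cong (_+ e) eq))) e≤1)

    module _ {v u : Vertex} where
      runD : site v ≡ D x → site u ≡ D (x ∸ 1) → ForcedRun graph (rank ∘ site) rank-proper site-injective g v u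
      runD eqv equ = record
        { run    = λ j → D (x ∸ j)
        ; run-0  = eqv
        ; run-1  = equ
        ; fresh  = λ { j _ eq → ∸-fresh x≢0 j (D-injective eq) }
        ; forced = λ { j lt {a} {b} eq (inj₁ l) _ → after j lt eq (site-valid a) (site-valid b) l
                     ; j lt {a} {b} eq (inj₂ l) _ → before j lt eq l }
        }
        where
        D-injective : ∀ {a b} → D a ≡ D b → a ≡ b
        D-injective refl = refl
        after : ∀ j → 2 + j < g → ∀ {σ τ} → σ ≡ D (x ∸ suc j) → Valid σ → Valid τ → Link σ τ → τ ≡ D (x ∸ j) ⊎ τ ≡ D (x ∸ (2 + j))
        after j lt eq _ _ rowD = inj₁ (cong D (trans (cong suc (D-injective eq)) (sym (pred-∸ (proj₁ (between j lt))))))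
        after j lt eq _ _ (down eq′) = ⊥-elim (proj₁ (proj₂ (between j lt)) _ _ (trans (sym (D-injective eq)) eq′))
        after j lt eq _ _ (return _) = contradiction (subst (0 <_) (sym (D-injective eq)) (proj₂ (proj₂ (between j lt)))) λ ()
        before : ∀ j → 2 + j < g → ∀ {σ τ} → τ ≡ D (x ∸ suc j) → Link σ τ → σ ≡ D (x ∸ j) ⊎ σ ≡ D (x ∸ (2 + j))
        before j lt eq rowD = inj₂ (cong D (∸-suc-pred x j (D-injective eq)))

      runT : x ≤ w → ¬ Left x → ¬ Right x → site v ≡ T x → site u ≡ T (x ∸ 1) →
        ForcedRun graph (rank ∘ site) rank-proper site-injective g v u
      runT x≤w ¬l ¬r eqv equ = record
        { run    = λ j → T (x ∸ j)
        ; run-0  = eqv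
        ; run-1  = equ
        ; fresh  = λ { j _ eq → ∸-fresh x≢0 j (T-injective eq) }
        ; forced = λ { j lt {a} {b} eq (inj₁ l) _ → after j lt eq l
                     ; j lt {a} {b} eq (inj₂ l) le → before j lt eq (subst (λ σ → _ ≤ rank σ) eqv le) l }
        }
        where
        T-injective : ∀ {a b} → T a ≡ T b → a ≡ b
        T-injective refl = refl
        clear : ∀ j → 2 + j < g → ∀ s′ t′ → x ∸ suc j ≢ X s′ t′
        clear j lt = proj₁ (proj₂ (between j lt))
        after : ∀ j → 2 + j < g → ∀ {σ τ} → σ ≡ T (x ∸ suc j) → Link σ τ → τ ≡ T (x ∸ j) ⊎ τ ≡ T (x ∸ (2 + j))
        after j lt refl rowT = inj₁ (cong T (sym (pred-∸ (proj₁ (between j lt)))))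
        after j lt refl (closer eq _) = ⊥-elim (clear j lt _ _ eq)
        before : ∀ j → 2 + j < g → ∀ {σ τ} → τ ≡ T (x ∸ suc j) → rank σ ≤ rank (T x) → Link σ τ → σ ≡ T (x ∸ j) ⊎ σ ≡ T (x ∸ (2 + j))
        before j lt eq _ rowT = inj₂ (cong T (∸-suc-pred x j (T-injective eq)))
        before j lt refl _ (up eq) = ⊥-elim (clear j lt _ _ eq)
        before j lt refl _ (closer _ eq) = ⊥-elim (clear j lt _ _ eq)
        -- The other end lies in row D, which outranks all of row T.
        before j lt refl le (return _) = ⊥-elim (<⇒≱ (rankT<rankD {y = 0} x≤w) le)

  -- The top of a cycle has one lower neighbour of each type, and the run leaves through the one of
  -- type `Main`: along a row, where `K` bounds it, or along a spine, where `m` does.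
  girth≥ : ∀ {g} → g ≤ K → g ≤ m → GirthAtLeast g graph
  girth≥ {g} g≤K g≤m = girth graph (rank ∘ site) rank-proper site-injective
    λ {v} {u₁} {u₂} u₁~v u₂~v u₁<v u₂<v u₁≢u₂ →
      choose refl refl refl (λ eq → u₁≢u₂ (site-injective eq)) (lower⇒Below u₁~v u₁<v) (lower⇒Below u₂~v u₂<v)
    where
    Run : Vertex → Vertex → Set
    Run = ForcedRun graph (rank ∘ site) rank-proper site-injective g

    run : ∀ {v u u′ τ σ σ′} → site v ≡ τ → site u ≡ σ → site u′ ≡ σ′ → Main σ τ → Side σ′ τ → Run v u
    run {v} v≡ u≡ _ rowD (down eq) = runD g≤K (trans (+-identityʳ _) eq) z≤n v≡ u≡
    run {v} v≡ u≡ _ (rowT ¬l ¬r) (closer _ eq) = ⊥-elim (¬r (_ , eq))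
    run {v} v≡ u≡ _ (rowT ¬l ¬r) (up _ _ eq) = runT g≤K (trans (+-identityʳ _) eq) z≤n (subst Valid v≡ (site-valid v)) ¬l ¬r v≡ u≡
    run {v} v≡ u≡ _ (rowT ¬l ¬r) (rowT _ _ (inj₁ (s , eq))) =
      runT g≤K {s = s} (trans (+-comm _ 1) eq) (s≤s z≤n) (subst Valid v≡ (site-valid v)) ¬l ¬r v≡ u≡
    run {v} v≡ u≡ _ (rowT ¬l ¬r) (rowT _ _ (inj₂ (s , eq))) =
      runT g≤K {s = s} (trans (+-comm _ 1) eq) (s≤s z≤n) (subst Valid v≡ (site-valid v)) ¬l ¬r v≡ u≡
    run _ _ _ (side eq) (up _ ¬r _) = ⊥-elim (¬r (_ , eq))
    run _ _ _ (side eq) (rowT _ ¬r _) = ⊥-elim (¬r (_ , eq))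
    -- From a right corner the run goes back along the spine. Row D and the inner vertices of row T
    -- outrank the corner, and the exit to the left corner lies beyond the first `g` vertices
    -- because `g ≤ m`.
    run {v} v≡ u≡ _ (side {s} {x} eq) (closer _ _) = record
      { run    = path
      ; run-0  = v≡
      ; run-1  = u≡
      ; fresh  = λ _ _ ()
      ; forced = λ { j lt {a} {b} e (inj₁ l) le → after j lt e (site-valid b) (bound le) l
                   ; j lt {a} {b} e (inj₂ l) le → before j lt e (bound le) l }
      }
      where
      path : ℕ → Site
      path zero    = T x
      path (suc j) = S s (n ∸ j)

      bound : ∀ {r} → r ≤ rank (site v) → r ≤ 2 + n
      bound le = subst (_ ≤_) (trans (cong rank v≡) (rank-right (s , eq))) le

      t>0 : ∀ {j} → 2 + j < g → n ∸ j ≢ 0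
      t>0 lt eq = <⇒≱ (ℕ.s≤s⁻¹ (≤-trans (n≤1+n _) (≤-trans lt g≤m))) (m∸n≡0⇒m≤n eq)

      n∸-suc : ∀ j → 2 + j < g → suc (n ∸ suc j) ≡ n ∸ j
      n∸-suc j lt = trans (cong suc (sym (pred[m∸n]≡m∸[1+n] n j))) (suc-pred (n ∸ j) {{ℕ.≢-nonZero (t>0 lt)}})

      S-injective : ∀ {s s′ t t′} → S s t ≡ S s′ t′ → s ≡ s′ × t ≡ t′
      S-injective refl = refl , refl

      after : ∀ j → 2 + j < g → ∀ {σ τ} → σ ≡ S s (n ∸ j) → Valid τ → rank τ ≤ 2 + n → Link σ τ → τ ≡ path j ⊎ τ ≡ path (2 + j)
      after zero lt refl v _ spine = ⊥-elim (1+n≰n v)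
      after (suc j) lt refl v _ spine = inj₁ (cong (S s) (n∸-suc j (<-trans (n<1+n _) lt)))
      after j lt refl v le (up {x = y} e) with corner? y
      ... | left s′ e′ = ⊥-elim (t>0 lt (proj₂ (X-injective {s} {s′} (m∸n≤m n j) z≤n (trans (sym e) e′))))
      ... | inner _ _ = ⊥-elim (<⇒≱ (s≤s (s≤s (s≤s (m≤m+n n y)))) le)
      ... | right s′ e′ = inj₁ (end j lt (proj₂ (X-injective {s} {s′} (m∸n≤m n j) ≤-refl (trans (sym e) e′))) e)
        where
        end : ∀ j → 2 + j < g → n ∸ j ≡ n → y ≡ X s (n ∸ j) → T y ≡ path j
        end zero    _  _  e = cong T (trans e (sym eq))
        end (suc j) lt e′ _ = ⊥-elim (1+n≰n (≤-trans
          (≤-reflexive (trans (cong suc (sym e′)) (n∸-suc j (<-trans (n<1+n _) lt)))) (m∸n≤m n j)))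

      before : ∀ j → 2 + j < g → ∀ {σ τ} → τ ≡ S s (n ∸ j) → rank σ ≤ 2 + n → Link σ τ → σ ≡ path j ⊎ σ ≡ path (2 + j)
      before j lt {σ} e le (spine {s′} {t}) with S-injective e
      ... | refl , e′ = inj₂ (cong (S s) (trans (cong (_∸ 1) e′) (pred[m∸n]≡m∸[1+n] n j)))
      before j lt e le (down {x = y} _) =
        ⊥-elim (<⇒≱ (s≤s (s≤s (s≤s (≤-trans (m≤m+n n (w + y)) (≤-trans (≤-reflexive (sym (+-assoc n w y))) (n≤1+n _)))))) le)

    choose : ∀ {v u₁ u₂ τ σ₁ σ₂} → site v ≡ τ → site u₁ ≡ σ₁ → site u₂ ≡ σ₂ → σ₁ ≢ σ₂ →
      Below σ₁ τ → Below σ₂ τ → Run v u₁ ⊎ Run v u₂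
    choose _ _ _ σ₁≢σ₂ (inj₁ p) (inj₁ q) = ⊥-elim (σ₁≢σ₂ (main-unique p q))
    choose v≡ u₁≡ u₂≡ _ (inj₁ p) (inj₂ q) = inj₁ (run v≡ u₁≡ u₂≡ p q)
    choose v≡ u₁≡ u₂≡ _ (inj₂ p) (inj₁ q) = inj₂ (run v≡ u₂≡ u₁≡ q p)
    choose {u₁ = u₁} {u₂} _ refl refl σ₁≢σ₂ (inj₂ p) (inj₂ q) = ⊥-elim (σ₁≢σ₂ (side-unique (site-valid u₁) (site-valid u₂) p q))

-- The plane drawing

record CellsIn (x₁ x₂ y₁ y₂ : ℕ) (p : Point) : Set where
  field
    {column row} : ℕ
    columnCell   : Cell (proj₁ p) column
    rowCell      : Cell (proj₂ p) row
    x₁≤          : 2 * x₁ ≤ column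
    ≤x₂          : column ≤ 2 * x₂
    y₁≤          : 2 * y₁ ≤ row
    ≤y₂          : row ≤ 2 * y₂

cells : ∀ {x₁ x₂ y₁ y₂ p} → InBox x₁ x₂ y₁ y₂ p → CellsIn x₁ x₂ y₁ y₂ p
cells {x₂ = x₂} {y₂ = y₂} (box l r f t)
  with cell x₂ (ℚ.≤-trans (ι-mono-≤ z≤n) l) r | cell y₂ (ℚ.≤-trans (ι-mono-≤ z≤n) f) t
... | _ , cx | _ , cy = record
  { columnCell = cx ; rowCell = cy
  ; x₁≤ = cell-lower cx l ; ≤x₂ = cell-upper cx r ; y₁≤ = cell-lower cy f ; ≤y₂ = cell-upper cy t }

data Trisection (a l u : ℕ) : Set where
  at-lower  : a ≡ l → Trisection a l u
  inside : l < a → a < u → Trisection a l u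
  at-upper  : a ≡ u → Trisection a l u

trisect : ∀ {a l u} → l ≤ a → a ≤ u → Trisection a l u
trisect {a} {l} {u} l≤a a≤u with a ≟ l | a ≟ u
... | yes a≡l | _       = at-lower a≡l
... | no _    | yes a≡u = at-upper a≡u
... | no a≢l  | no a≢u  = inside (≤∧≢⇒< l≤a (a≢l ∘ sym)) (≤∧≢⇒< a≤u a≢u)

inside-unit : ∀ {a x} → 2 * x < a → a < 2 * suc x → a ≡ suc (2 * x)
inside-unit {a} {x} l u = ≤-antisym (ℕ.s≤s⁻¹ (subst (a <_) (*-suc 2 x) u)) l

module Drawing (n K : ℕ) (0<n : 0 < n) (2≤K : 2 ≤ K) where
  open Wall n K 0<n 2≤K

  abscissa ordinate : Site → ℕ
  abscissa (D x)   = x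
  abscissa (S s t) = X s t
  abscissa (T x)   = x
  ordinate (D x)   = 1
  ordinate (S s t) = 2
  ordinate (T x)   = 3

  pt : Site → Point
  pt σ = abscissa σ ,, ordinate σ

  abscissa≤w : ∀ σ → Valid σ → abscissa σ ≤ w
  abscissa≤w (D x)   x≤w = x≤w
  abscissa≤w (S s t) t≤n = <⇒≤ (X<w s t≤n)
  abscissa≤w (T x)   x≤w = x≤w

  pt-injective : ∀ {σ τ} → Valid σ → Valid τ → pt σ ≡ pt τ → σ ≡ τ
  pt-injective {σ} {τ} v v′ eq = go σ τ v v′ (proj₁ (grid-injective eq)) (proj₂ (grid-injective eq))
    where
    go : ∀ σ τ → Valid σ → Valid τ → abscissa σ ≡ abscissa τ → ordinate σ ≡ ordinate τ → σ ≡ τ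
    go (D x) (D y) _ _ refl _ = refl
    go (T x) (T y) _ _ refl _ = refl
    go (S s t) (S s′ t′) v v′ eq _ with X-injective {s} {s′} v v′ eq
    ... | refl , refl = refl
    go (D x) (S s t) _ _ _ ()
    go (D x) (T y) _ _ _ ()
    go (S s t) (D x) _ _ _ ()
    go (S s t) (T x) _ _ _ ()
    go (T x) (D y) _ _ _ ()
    go (T x) (S s t) _ _ _ ()

  -- The two sorts of links in row T are told apart by their ends: consecutive vertices are joined
  -- directly, the ends of a closer by an arch at height 4.
  routeT : ∀ x y → Dec (y ≡ suc x) → Polyline (x ,, 3) (y ,, 3)
  routeT x y (yes _) = segment (x ,, 3) (y ,, 3)
  routeT x y (no _)  = bend (x ,, 3) {x ,, 4} (bend (x ,, 4) {y ,, 4} (segment (y ,, 4) (y ,, 3)))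

  -- The edge `return` passes around the drawing, below row D at height 0 and then to the right of
  -- abscissa `w`.
  route : ∀ σ τ → Polyline (pt σ) (pt τ)
  route (T x)     (T y)       = routeT x y (y ≟ suc x)
  route (D x)     (T y)       =
    bend (x ,, 1) {x ,, 0} (bend (x ,, 0) {suc y ,, 0} (bend (suc y ,, 0) {suc y ,, 3} (segment (suc y ,, 3) (y ,, 3))))
  route (D x)     τ@(D _)     = segment (x ,, 1) (pt τ)
  route (D x)     τ@(S _ _)   = segment (x ,, 1) (pt τ)
  route σ@(S _ _) τ           = segment (pt σ) (pt τ)
  route σ@(T _)   τ@(D _)     = segment (pt σ) (pt τ)
  route σ@(T _)   τ@(S _ _)   = segment (pt σ) (pt τ)

  -- As in Cell, coordinates are doubled and an odd number stands for an open unit interval.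
  data Inner : Site → Site → ℕ → ℕ → Set where
    rowD  : ∀ {x a} → x < w → a ≡ suc (2 * x) → Inner (D x) (D (suc x)) a 2
    rowT  : ∀ {x a} → x < w → a ≡ suc (2 * x) → Inner (T x) (T (suc x)) a 6
    spine : ∀ {s t a} → t < n → 2 * X s t < a → a < 2 * X s (suc t) → Inner (S s t) (S s (suc t)) a 4
    down  : ∀ {s t a} → t ≤ n → a ≡ 2 * X s t → Inner (D (X s t)) (S s t) a 3
    up    : ∀ {s t a} → t ≤ n → a ≡ 2 * X s t → Inner (S s t) (T (X s t)) a 5
    leg   : ∀ {s a} → 2 * X s 0 ≤ a → a ≤ 2 * X s n → Inner (T (X s 0)) (T (X s n)) a 7
    roof  : ∀ {s a} → 2 * X s 0 ≤ a → a ≤ 2 * X s n → Inner (T (X s 0)) (T (X s n)) a 8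

  -- The cells reserved for a link, generous enough to contain its arc apart from the two ends. A
  -- closer owns the whole strip above its gadget, `return` everything below row D or right of `w`.
  data Own : Site → Site → ℕ → ℕ → Set where
    inner  : ∀ {σ τ a b} → Inner σ τ a b → Own σ τ a b
    return : ∀ {a b} → b ≤ 1 ⊎ 2 * w < a → Own (D 0) (T w) a b

  inner-above : ∀ {σ τ a b} → Inner σ τ a b → 1 < b
  inner-above (rowD _ _)    = s≤s (s≤s z≤n)
  inner-above (rowT _ _)    = s≤s (s≤s z≤n)
  inner-above (spine _ _ _) = s≤s (s≤s z≤n)
  inner-above (down _ _)    = s≤s (s≤s z≤n)
  inner-above (up _ _)      = s≤s (s≤s z≤n)
  inner-above (leg _ _)     = s≤s (s≤s z≤n)
  inner-above (roof _ _)    = s≤s (s≤s z≤n)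

  inner-left : ∀ {σ τ a b} → Inner σ τ a b → a ≤ 2 * w
  inner-left (rowD {x} x<w refl) = ≤-trans (n≤1+n _) (≤-trans (≤-reflexive (sym (*-suc 2 x))) (*-monoʳ-≤ 2 x<w))
  inner-left (rowT {x} x<w refl) = ≤-trans (n≤1+n _) (≤-trans (≤-reflexive (sym (*-suc 2 x))) (*-monoʳ-≤ 2 x<w))
  inner-left (spine {s} t<n _ u) = ≤-trans (<⇒≤ u) (*-monoʳ-≤ 2 (<⇒≤ (X<w s t<n)))
  inner-left (down {s} t≤n refl) = *-monoʳ-≤ 2 (<⇒≤ (X<w s t≤n))
  inner-left (up {s} t≤n refl)   = *-monoʳ-≤ 2 (<⇒≤ (X<w s t≤n))
  inner-left (leg {s} _ u)       = ≤-trans u (*-monoʳ-≤ 2 (<⇒≤ (X<w s ≤-refl)))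
  inner-left (roof {s} _ u)      = ≤-trans u (*-monoʳ-≤ 2 (<⇒≤ (X<w s ≤-refl)))

  odd-unique : ∀ {a x y : ℕ} → a ≡ suc (2 * x) → a ≡ suc (2 * y) → x ≡ y
  odd-unique {x = x} {y} refl eq = *-cancelˡ-≡ x y 2 (suc-injective eq)

  even-unique : ∀ {a x y : ℕ} → a ≡ 2 * x → a ≡ 2 * y → x ≡ y
  even-unique {x = x} {y} refl eq = *-cancelˡ-≡ x y 2 eq

  X-suc : ∀ s t → 2 * X s (suc t) ≡ (2 * K) * suc (col s t)
  X-suc s t = trans (cong (λ c → 2 * (K * c)) (col-suc s t)) (sym (*-assoc 2 K _))

  -- Division of the doubled abscissa by `2 * K` recovers the column.
  spine-unique : ∀ {s s′ t t′ a} → t ≤ n → t′ ≤ n → 2 * X s t ≤ a → a < 2 * X s (suc t) →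
    2 * X s′ t′ ≤ a → a < 2 * X s′ (suc t′) → s ≡ s′ × t ≡ t′
  spine-unique {s} {s′} {t} {t′} {a} v v′ l u l′ u′ = col-injective v v′ (quotient-unique (2 * K) {col s t} {col s′ t′}
    (subst (_≤ a) (sym (*-assoc 2 K _)) l) (subst (a <_) (X-suc s t) u)
    (subst (_≤ a) (sym (*-assoc 2 K _)) l′) (subst (a <_) (X-suc s′ t′) u′))

  gadget-unique : ∀ {s s′ a} → 2 * X s 0 ≤ a → a ≤ 2 * X s n → 2 * X s′ 0 ≤ a → a ≤ 2 * X s′ n → s ≡ s′
  gadget-unique {s} {s′} l u l′ u′ = go (<-cmp (toℕ s) (toℕ s′))
    where
    before : ∀ {s s′ a} → toℕ s < toℕ s′ → a ≤ 2 * X s n → ¬ 2 * X s′ 0 ≤ a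
    before {s} {s′} s<s′ u l′ = <⇒≱ (*-monoʳ-< 2 (*-monoʳ-< K (col-mono-digit {s} {s′} n ≤-refl s<s′))) (≤-trans l′ u)
    go : Tri _ _ _ → s ≡ s′
    go (tri< s<s′ _ _) = ⊥-elim (before {s} {s′} s<s′ u l′)
    go (tri≈ _ s≡s′ _) = toℕ-injective s≡s′
    go (tri> _ _ s′<s) = ⊥-elim (before {s′} {s} s′<s u′ l)

  inner-unique : ∀ {σ τ σ′ τ′ a b} → Inner σ τ a b → Inner σ′ τ′ a b → σ ≡ σ′ × τ ≡ τ′
  inner-unique (rowD {x} _ e) (rowD {y} _ e′) with odd-unique {x = x} {y} e e′
  ... | refl = refl , refl
  inner-unique (rowT {x} _ e) (rowT {y} _ e′) with odd-unique {x = x} {y} e e′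
  ... | refl = refl , refl
  inner-unique (spine {s} {t} v l u) (spine {s′} {t′} v′ l′ u′)
    with spine-unique {s} {s′} {t} {t′} (<⇒≤ v) (<⇒≤ v′) (<⇒≤ l) u (<⇒≤ l′) u′
  ... | refl , refl = refl , refl
  inner-unique (down {s} {t} v e) (down {s′} {t′} v′ e′)
    with X-injective {s} {s′} v v′ (even-unique {x = X s t} {X s′ t′} e e′)
  ... | refl , refl = refl , refl
  inner-unique (up {s} {t} v e) (up {s′} {t′} v′ e′)
    with X-injective {s} {s′} v v′ (even-unique {x = X s t} {X s′ t′} e e′)
  ... | refl , refl = refl , refl
  inner-unique (leg {s} l u) (leg {s′} l′ u′) with gadget-unique {s} {s′} l u l′ u′
  ... | refl = refl , refl
  inner-unique (roof {s} l u) (roof {s′} l′ u′) with gadget-unique {s} {s′} l u l′ u′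
  ... | refl = refl , refl

  own-unique : ∀ {σ τ σ′ τ′ a b} → Own σ τ a b → Own σ′ τ′ a b → σ ≡ σ′ × τ ≡ τ′
  own-unique (inner i)           (inner j)           = inner-unique i j
  own-unique (inner i)           (return (inj₁ b≤1)) = ⊥-elim (<⇒≱ (inner-above i) b≤1)
  own-unique (inner i)           (return (inj₂ w<a)) = ⊥-elim (<⇒≱ w<a (inner-left i))
  own-unique (return (inj₁ b≤1)) (inner i)           = ⊥-elim (<⇒≱ (inner-above i) b≤1)
  own-unique (return (inj₂ w<a)) (inner i)           = ⊥-elim (<⇒≱ w<a (inner-left i))
  own-unique (return _)          (return _)          = refl , refl

  -- Vertices have even coordinates in the doubled rows 2, 4 and 6. Row edges occupy odd columns,
  -- vertical edges and arches occupy other rows, and a spine edge stays strictly between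
  -- neighbouring columns.
  own-not-vertex : ∀ {σ τ a b} ω → Valid ω → Own σ τ a b → a ≡ 2 * abscissa ω → b ≡ 2 * ordinate ω → ⊥
  own-not-vertex ω _ (inner (rowD {x} _ e)) e′ _ = even≢odd (abscissa ω) x (trans (sym e′) e)
  own-not-vertex ω _ (inner (rowT {x} _ e)) e′ _ = even≢odd (abscissa ω) x (trans (sym e′) e)
  own-not-vertex (D _)     _ (inner (spine _ _ _)) _ ()
  own-not-vertex (T _)     _ (inner (spine _ _ _)) _ ()
  own-not-vertex (S s′ t′) v (inner (spine {s} {t} t<n l u)) refl _
    with spine-unique {s} {s′} {t} {t′} (<⇒≤ t<n) v (<⇒≤ l) u ≤-refl (*-monoʳ-< 2 (X-mono-< s′ (n<1+n t′)))
  ... | refl , refl = <-irrefl refl l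
  own-not-vertex (D _)   _ (inner (down _ _)) _ ()
  own-not-vertex (S _ _) _ (inner (down _ _)) _ ()
  own-not-vertex (T _)   _ (inner (down _ _)) _ ()
  own-not-vertex (D _)   _ (inner (up _ _))   _ ()
  own-not-vertex (S _ _) _ (inner (up _ _))   _ ()
  own-not-vertex (T _)   _ (inner (up _ _))   _ ()
  own-not-vertex (D _)   _ (inner (leg _ _))  _ ()
  own-not-vertex (S _ _) _ (inner (leg _ _))  _ ()
  own-not-vertex (T _)   _ (inner (leg _ _))  _ ()
  own-not-vertex (D _)   _ (inner (roof _ _)) _ ()
  own-not-vertex (S _ _) _ (inner (roof _ _)) _ ()
  own-not-vertex (T _)   _ (inner (roof _ _)) _ ()
  own-not-vertex (D _)   _ (return (inj₁ (s≤s ()))) _ refl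
  own-not-vertex (S _ _) _ (return (inj₁ (s≤s ()))) _ refl
  own-not-vertex (T _)   _ (return (inj₁ (s≤s ()))) _ refl
  own-not-vertex ω v (return (inj₂ w<a)) refl _ = <⇒≱ w<a (*-monoʳ-≤ 2 (abscissa≤w ω v))

  -- Points on the arcs

  data Location (σ τ : Site) (p : Point) : Set where
    start : p ≡ pt σ → Location σ τ p
    end   : p ≡ pt τ → Location σ τ p
    own   : ∀ {a b} → Cell (proj₁ p) a → Cell (proj₂ p) b → Own σ τ a b → Location σ τ p

  grid-point : ∀ {p a b x y} → Cell (proj₁ p) a → Cell (proj₂ p) b → a ≡ 2 * x → b ≡ 2 * y → p ≡ x ,, y
  grid-point cx cy a≡ b≡ = cong₂ _,_ (cell-even cx a≡) (cell-even cy b≡)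

  -- The box of a segment fixes one coordinate; comparing the other one with its bounds separates
  -- the ends of the edge from the reserved cells.
  locate : ∀ {σ τ} → Valid σ → Valid τ → Link σ τ → ∀ {p} → OnPolyline (route σ τ) p → Location σ τ p
  locate _ v (rowD {x}) on with cells (horizontal⊆box (n≤1+n x) on)
  ... | record { columnCell = cx ; rowCell = cy ; x₁≤ = l ; ≤x₂ = r ; y₁≤ = f ; ≤y₂ = t } with ≤-antisym t f | trisect l r
  ...   | b≡ | at-lower a≡ = start (grid-point cx cy a≡ b≡)
  ...   | b≡ | at-upper a≡ = end (grid-point cx cy a≡ b≡)
  ...   | refl | inside l u = own cx cy (inner (rowD v (inside-unit l u)))
  locate _ v (rowT {x}) on with suc x ≟ suc x
  ... | no x≢x = ⊥-elim (x≢x refl)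
  ... | yes _ with cells (horizontal⊆box (n≤1+n x) on)
  ...   | record { columnCell = cx ; rowCell = cy ; x₁≤ = l ; ≤x₂ = r ; y₁≤ = f ; ≤y₂ = t } with ≤-antisym t f | trisect l r
  ...     | b≡ | at-lower a≡ = start (grid-point cx cy a≡ b≡)
  ...     | b≡ | at-upper a≡ = end (grid-point cx cy a≡ b≡)
  ...     | refl | inside l u = own cx cy (inner (rowT v (inside-unit l u)))
  locate _ v (spine {s} {t}) on with cells (horizontal⊆box (X-mono-≤ s (n≤1+n t)) on)
  ... | record { columnCell = cx ; rowCell = cy ; x₁≤ = l ; ≤x₂ = r ; y₁≤ = f ; ≤y₂ = t } with ≤-antisym t f | trisect l r
  ...   | b≡ | at-lower a≡ = start (grid-point cx cy a≡ b≡)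
  ...   | b≡ | at-upper a≡ = end (grid-point cx cy a≡ b≡)
  ...   | refl | inside l u = own cx cy (inner (spine v l u))
  locate _ v (down refl) on with cells (vertical⊆box (n≤1+n 1) on)
  ... | record { columnCell = cx ; rowCell = cy ; x₁≤ = l ; ≤x₂ = r ; y₁≤ = f ; ≤y₂ = t } with ≤-antisym r l | trisect f t
  ...   | a≡ | at-lower b≡ = start (grid-point cx cy a≡ b≡)
  ...   | a≡ | at-upper b≡ = end (grid-point cx cy a≡ b≡)
  ...   | a≡ | inside l u with inside-unit {x = 1} l u
  ...     | refl = own cx cy (inner (down v a≡))
  locate v _ (up refl) on with cells (vertical⊆box (n≤1+n 2) on)
  ... | record { columnCell = cx ; rowCell = cy ; x₁≤ = l ; ≤x₂ = r ; y₁≤ = f ; ≤y₂ = t } with ≤-antisym r l | trisect f t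
  ...   | a≡ | at-lower b≡ = start (grid-point cx cy a≡ b≡)
  ...   | a≡ | at-upper b≡ = end (grid-point cx cy a≡ b≡)
  ...   | a≡ | inside l u with inside-unit {x = 2} l u
  ...     | refl = own cx cy (inner (up v a≡))
  locate _ _ (closer {s} {x} {y} refl refl) {p} on with y ≟ suc x
  ... | yes eq = ⊥-elim (not-adjacent-columns {s} {s} {0} {n} (sym eq))
  ... | no y≢ = go on
    where
    x≤y : 2 * x ≤ 2 * y
    x≤y = *-monoʳ-≤ 2 (X-mono-≤ s z≤n)

    -- Both posts of the arch are treated together: `z` is the abscissa of either one, and `foot`
    -- identifies its lower end as an end of the edge.
    post : ∀ {z} → (p ≡ z ,, 3 → Location (T x) (T y) p) → 2 * x ≤ 2 * z → 2 * z ≤ 2 * y → InBox z z 3 4 p → Location (T x) (T y) p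
    post foot x≤z z≤y b with cells b
    ... | record { columnCell = cx ; rowCell = cy ; x₁≤ = l ; ≤x₂ = r ; y₁≤ = f ; ≤y₂ = t } with ≤-antisym r l | trisect f t
    ...   | a≡   | at-lower b≡ = foot (grid-point cx cy a≡ b≡)
    ...   | refl | at-upper refl = own cx cy (inner (roof x≤z z≤y))
    ...   | refl | inside l u with inside-unit {x = 3} l u
    ...     | refl = own cx cy (inner (leg x≤z z≤y))

    go : OnPolyline (routeT x y (no y≢)) p → Location (T x) (T y) p
    go (inj₁ on) = post start ≤-refl x≤y (vertical⊆box (n≤1+n 3) on)
    go (inj₂ (inj₁ on)) with cells (horizontal⊆box (X-mono-≤ s z≤n) on)
    ... | record { columnCell = cx ; rowCell = cy ; x₁≤ = l ; ≤x₂ = r ; y₁≤ = f ; ≤y₂ = t } with ≤-antisym t f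
    ...   | refl = own cx cy (inner (roof l r))
    go (inj₂ (inj₂ on)) = post end x≤y ≤-refl (vertical⊆box′ (n≤1+n 3) on)
  locate _ _ (return refl) (inj₁ on) with cells (vertical⊆box′ (n≤1+n 0) on)
  ... | record { columnCell = cx ; rowCell = cy ; x₁≤ = l ; ≤x₂ = r ; y₁≤ = f ; ≤y₂ = t } with ≤-antisym r l | trisect f t
  ...   | a≡ | at-upper b≡ = start (grid-point cx cy a≡ b≡)
  ...   | a≡ | at-lower refl = own cx cy (return (inj₁ z≤n))
  ...   | a≡ | inside l u = own cx cy (return (inj₁ (ℕ.s≤s⁻¹ u)))
  locate _ _ (return refl) (inj₂ (inj₁ on)) with cells (horizontal⊆box z≤n on)
  ... | record { columnCell = cx ; rowCell = cy ; ≤y₂ = t } = own cx cy (return (inj₁ (≤-trans t z≤n)))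
  locate _ _ (return refl) (inj₂ (inj₂ (inj₁ on))) with cells (vertical⊆box z≤n on)
  ... | record { columnCell = cx ; rowCell = cy ; x₁≤ = l } = own cx cy (return (inj₂ (≤-trans (*-monoʳ-< 2 (n<1+n w)) l)))
  locate _ _ (return refl) (inj₂ (inj₂ (inj₂ on))) with cells (horizontal⊆box′ (n≤1+n w) on)
  ... | record { columnCell = cx ; rowCell = cy ; x₁≤ = l ; ≤x₂ = r ; y₁≤ = f ; ≤y₂ = t } with ≤-antisym t f | trisect l r
  ...   | b≡ | at-lower a≡ = end (grid-point cx cy a≡ b≡)
  ...   | b≡ | at-upper refl = own cx cy (return (inj₂ (*-monoʳ-< 2 (n<1+n w))))
  ...   | b≡ | inside w<a _ = own cx cy (return (inj₂ w<a))

  link-irreflexive : ∀ {σ τ} → Valid σ → Valid τ → Link σ τ → pt σ ≢ pt τ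
  link-irreflexive v v′ l eq with pt-injective v v′ eq
  ... | refl = <-irrefl refl (link-code v v′ l)

  grid≢ : ∀ {x y x′ y′} → x ≢ x′ ⊎ y ≢ y′ → x ,, y ≢ x′ ,, y′
  grid≢ (inj₁ x≢) eq = x≢ (proj₁ (grid-injective eq))
  grid≢ (inj₂ y≢) eq = y≢ (proj₂ (grid-injective eq))

  corner : ∀ {p x y x₁ x₂ y₁ y₂} → InBox x x y₁ y₂ p → InBox x₁ x₂ y y p → p ≡ x ,, y
  corner (box l r _ _) (box _ _ f t) = cong₂ _,_ (ℚ.≤-antisym r l) (ℚ.≤-antisym t f)

  disjoint-columns : ∀ {p x₁ x₂ x₃ x₄ y₁ y₂ y₃ y₄} → x₂ < x₃ → InBox x₁ x₂ y₁ y₂ p → ¬ InBox x₃ x₄ y₃ y₄ p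
  disjoint-columns x₂<x₃ (box _ r _ _) (box l _ _ _) = <⇒≱ x₂<x₃ (ι-cancel-≤ (ℚ.≤-trans l r))

  disjoint-rows : ∀ {p x₁ x₂ x₃ x₄ y₁ y₂ y₃ y₄} → y₂ < y₃ → InBox x₁ x₂ y₁ y₂ p → ¬ InBox x₃ x₄ y₃ y₄ p
  disjoint-rows y₂<y₃ (box _ _ _ t) (box _ _ f _) = <⇒≱ y₂<y₃ (ι-cancel-≤ (ℚ.≤-trans f t))

  0<w : 0 < w
  0<w = ≤-trans (s≤s z≤n) (X<w zero {0} z≤n)

  -- Successive segments of an arc are perpendicular and meet only at their bend; all other pairs
  -- lie in separate columns or rows.
  route-simple : ∀ {σ τ} → Valid σ → Valid τ → Link σ τ → Simple (route σ τ)
  route-simple v v′ rowD     = link-irreflexive v v′ rowD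
  route-simple v v′ (rowT {x}) with suc x ≟ suc x
  ... | yes _ = link-irreflexive v v′ rowT
  ... | no x≢x = ⊥-elim (x≢x refl)
  route-simple v v′ (spine {s} {t}) = link-irreflexive v v′ (spine {s} {t})
  route-simple v v′ (down e)  = link-irreflexive v v′ (down e)
  route-simple v v′ (up e)    = link-irreflexive v v′ (up e)
  route-simple v v′ (closer {s} {x} {y} refl refl) with y ≟ suc x
  ... | yes eq = ⊥-elim (not-adjacent-columns {s} {s} {0} {n} (sym eq))
  ... | no _   =
    grid≢ (inj₂ λ ()) ,
    (grid≢ (inj₁ (<⇒≢ x<y)) ,
     grid≢ (inj₂ λ ()) ,
     λ p beam post → corner (vertical⊆box′ (n≤1+n 3) post) (horizontal⊆box (<⇒≤ x<y) beam)) ,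
    λ { p post (inj₁ beam)  → corner (vertical⊆box (n≤1+n 3) post) (horizontal⊆box (<⇒≤ x<y) beam)
      ; p post (inj₂ post′) → ⊥-elim (disjoint-columns x<y (vertical⊆box (n≤1+n 3) post) (vertical⊆box′ (n≤1+n 3) post′)) }
    where
    x<y : x < y
    x<y = X-mono-< s 0<n
  route-simple v v′ (return refl) =
    grid≢ (inj₂ λ ()) ,
    (grid≢ (inj₁ λ ()) ,
     (grid≢ (inj₂ λ ()) ,
      grid≢ (inj₁ 1+n≢n) ,
      λ p rise top → corner (vertical⊆box z≤n rise) (horizontal⊆box′ (n≤1+n w) top)) ,
     λ { p bottom (inj₁ rise) → corner (vertical⊆box z≤n rise) (horizontal⊆box z≤n bottom)
       ; p bottom (inj₂ top)   → ⊥-elim (disjoint-rows (s≤s z≤n) (horizontal⊆box z≤n bottom) (horizontal⊆box′ (n≤1+n w) top)) }) ,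
    λ { p drop (inj₁ bottom)       → corner (vertical⊆box′ (n≤1+n 0) drop) (horizontal⊆box z≤n bottom)
      ; p drop (inj₂ (inj₁ rise)) → ⊥-elim (disjoint-columns (s≤s z≤n) (vertical⊆box′ (n≤1+n 0) drop) (vertical⊆box z≤n rise))
      ; p drop (inj₂ (inj₂ top))   → ⊥-elim (disjoint-columns 0<w (vertical⊆box′ (n≤1+n 0) drop) (horizontal⊆box′ (n≤1+n w) top)) }

  planar : Planar graph
  planar = record
    { position            = pt ∘ site
    ; position-inj        = λ {u} {v} eq → site-injective (pt-injective (site-valid u) (site-valid v) eq)
    ; arc                 = λ u v → route (site u) (site v)
    ; arc-simple          = λ {u} {v} e → route-simple (site-valid u) (site-valid v) (link e)
    ; arc-avoids-vertices = λ {u} {v} e w on → avoid w (locate (site-valid u) (site-valid v) (link e) on)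
    ; no-crossing         = λ {u} {v} {u′} {v′} e e′ e≢e′ p on on′ → meet e≢e′
        (locate (site-valid u) (site-valid v) (link e) on) (locate (site-valid u′) (site-valid v′) (link e′) on′)
    }
    where
    open Graph graph

    link : ∀ {u v} → toℕ u < toℕ v × u ~ v → Link (site u) (site v)
    link (_   , inj₁ l) = l
    link {u} {v} (u<v , inj₂ l) = ⊥-elim (<-asym u<v
      (subst₂ _<_ (sym (toℕ≡code v)) (sym (toℕ≡code u)) (link-code (site-valid v) (site-valid u) l)))

    avoid : ∀ {u v} w → Location (site u) (site v) (pt (site w)) → w ≡ u ⊎ w ≡ v
    avoid {u} {v} w (start eq) = inj₁ (site-injective (pt-injective (site-valid w) (site-valid u) eq))
    avoid {u} {v} w (end eq)   = inj₂ (site-injective (pt-injective (site-valid w) (site-valid v) eq))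
    avoid w (own cx cy o)      = ⊥-elim (own-not-vertex (site w) (site-valid w) o
      (cell-unique cx (point (abscissa (site w)) refl)) (cell-unique cy (point (ordinate (site w)) refl)))

    meet : ∀ {u v u′ v′ p} → (u , v) ≢ (u′ , v′) → Location (site u) (site v) p → Location (site u′) (site v′) p →
      ∃ λ w → p ≡ pt (site w)
    meet {u} _ (start eq) _ = u , eq
    meet {v = v} _ (end eq) _ = v , eq
    meet {u′ = u′} _ (own _ _ _) (start eq) = u′ , eq
    meet {v′ = v′} _ (own _ _ _) (end eq) = v′ , eq
    -- A common point lies in a single cell, and that cell is reserved for one link only.
    meet e≢e′ (own cx cy o) (own cx′ cy′ o′) with cell-unique cx cx′ | cell-unique cy cy′
    ... | refl | refl with own-unique o o′
    ...   | u≡ , v≡ = ⊥-elim (e≢e′ (cong₂ _,_ (site-injective u≡) (site-injective v≡)))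

-- The lower bound

Kind : Set
Kind = Fin 3

Perm : Set
Perm = Fin 6

-- Kinds 0, 1, 2 are the lists A, B, C.
outerKind innerKind : Fin 3 → Kind
outerKind 0F = 0F
outerKind 1F = 2F
outerKind 2F = 2F
innerKind 0F = 1F
innerKind 1F = 1F
innerKind 2F = 0F

-- outerPrivate s is the index of the colour of outerKind s that is missing in innerKind s, and conversely.
outerPrivate innerPrivate : Fin 3 → Fin 3
outerPrivate 0F = 2F
outerPrivate 1F = 1F
outerPrivate 2F = 2F
innerPrivate 0F = 2F
innerPrivate 1F = 1F
innerPrivate 2F = 1F

-- Whether replacing the private colour of outerKind s by that of innerKind s reverses the sign,
-- signs being taken relative to the increasing order of the palettes.
opposite : Fin 3 → Bool → Bool → Bool
opposite 0F a b = a xor b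
opposite 1F a b = a xor b
opposite 2F a b = not (a xor b)

-- Permutations of three colours

abstract
  colour : Kind → Fin 3 → ℕ
  colour k i = Vec.lookup (Vec.lookup palettes k) i
    where
    palettes : Vec (Vec ℕ 3) 3
    palettes = (1 ∷ 2 ∷ 3 ∷ []) ∷ (1 ∷ 2 ∷ 4 ∷ []) ∷ (1 ∷ 3 ∷ 4 ∷ []) ∷ []

  -- One-line notation, with the three even permutations first, as `sign` expects.
  entry : Perm → Fin 3 → Fin 3
  entry p i = Vec.lookup (Vec.lookup permutations p) i
    where
    permutations : Vec (Vec (Fin 3) 3) 6
    permutations =
      (0F ∷ 1F ∷ 2F ∷ []) ∷ (1F ∷ 2F ∷ 0F ∷ []) ∷ (2F ∷ 0F ∷ 1F ∷ []) ∷
      (0F ∷ 2F ∷ 1F ∷ []) ∷ (1F ∷ 0F ∷ 2F ∷ []) ∷ (2F ∷ 1F ∷ 0F ∷ []) ∷ []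

  sign : Perm → Bool
  sign = Vec.lookup (true ∷ true ∷ true ∷ false ∷ false ∷ false ∷ [])

  -- For a permutation read off a packing, this tells which of the three colourings uses a given
  -- colour of the list.
  inverse : Perm → Fin 3 → Fin 3
  inverse p = entry (Vec.lookup (0F ∷ 2F ∷ 1F ∷ 3F ∷ 4F ∷ 5F ∷ []) p)


Compatible : Kind → Perm → Kind → Perm → Set
Compatible k p l q = ∀ i → colour k (entry p i) ≢ colour l (entry q i)

abstract
  compatible? : ∀ k p l q → Dec (Compatible k p l q)
  compatible? k p l q = all? λ i → ¬? (colour k (entry p i) ℕ.≟ colour l (entry q i))

  colour-injective : ∀ k i j → colour k i ≡ colour k j → i ≡ j
  colour-injective = from-yes (all? λ k → all? λ i → all? λ j →
    (colour k i ℕ.≟ colour k j) →-dec (i Fin.≟ j))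

  to-perm : ∀ a b c → a ≢ b → a ≢ c → b ≢ c → ∃ λ p → entry p 0F ≡ a × entry p 1F ≡ b × entry p 2F ≡ c
  to-perm = from-yes (all? λ a → all? λ b → all? λ c →
    ¬? (a Fin.≟ b) →-dec (¬? (a Fin.≟ c) →-dec (¬? (b Fin.≟ c) →-dec
    any? λ p → entry p 0F Fin.≟ a ×-dec (entry p 1F Fin.≟ b ×-dec entry p 2F Fin.≟ c))))

  -- The two permutations differ by a derangement of three points, which is a 3-cycle and hence
  -- even.
  same-sign : ∀ k p q → Compatible k p k q → sign p ≡ sign q
  same-sign = from-yes (all? λ k → all? λ p → all? λ q →
    compatible? k p k q →-dec (sign p Bool.≟ sign q))

  moved : ∀ k p q → Compatible k p k q → ∀ i → inverse p i ≢ inverse q i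
  moved = from-yes (all? λ k → all? λ p → all? λ q →
    compatible? k p k q →-dec (all? λ i → ¬? (inverse p i Fin.≟ inverse q i)))

  -- Once the two private colours are identified, permutations of opposite sign differ by a
  -- transposition. Its fixed colour cannot be common to both lists, so it is the private one.
  private-aligned : ∀ s p q → Compatible (outerKind s) p (innerKind s) q → opposite s (sign p) (sign q) ≡ true →
    inverse p (outerPrivate s) ≡ inverse q (innerPrivate s)
  private-aligned = from-yes (all? λ s → all? λ p → all? λ q →
    compatible? (outerKind s) p (innerKind s) q →-dec ((opposite s (sign p) (sign q) Bool.≟ true) →-dec
    (inverse p (outerPrivate s) Fin.≟ inverse q (innerPrivate s))))

-- The three transpositions compose to a transposition, so they cannot all preserve the sign.
some-opposite : ∀ a b c → opposite 0F a b ≡ true ⊎ opposite 1F c b ≡ true ⊎ opposite 2F c a ≡ true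
some-opposite false false false = inj₂ (inj₂ refl)
some-opposite false false true  = inj₂ (inj₁ refl)
some-opposite false true  _     = inj₁ refl
some-opposite true  false _     = inj₁ refl
some-opposite true  true  false = inj₂ (inj₁ refl)
some-opposite true  true  true  = inj₂ (inj₂ refl)

alternate : ∀ {A : Set} → ℕ → A → A → A
alternate zero    a b = a
alternate (suc t) a b = alternate t b a

-- It quantifies over all `A` because lists, signs and private colours alternate simultaneously
-- along a spine.
data Parity (t : ℕ) : Set₁ where
  even : (∀ {A : Set} (a b : A) → alternate t a b ≡ a) → Parity t
  odd  : (∀ {A : Set} (a b : A) → alternate t a b ≡ b) → Parity t

parity : ∀ t → Parity t
parity zero = even λ _ _ → refl
parity (suc t) with parity t
... | even e = odd λ a b → e b a
... | odd e  = even λ a b → e b a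

alternate-even : ∀ q {A : Set} (a b : A) → alternate (2 * q) a b ≡ a
alternate-even zero    a b = refl
alternate-even (suc q) a b = trans (cong (λ t → alternate t a b) (*-suc 2 q)) (alternate-even q a b)

constant-on : ∀ {A : Set} (f : ℕ → A) {l u} → (∀ x → l ≤ x → x < u → f x ≡ f (suc x)) →
  ∀ {x} → l ≤ x → x ≤ u → f l ≡ f x
constant-on f {l} {u} step {x} l≤x x≤u = go x l≤x x≤u
  where
  go : ∀ x → l ≤ x → x ≤ u → f l ≡ f x
  go x l≤x x≤u with m≤n⇒m<n∨m≡n l≤x
  go x       l≤x x≤u | inj₂ refl = refl
  go (suc x) l≤x x≤u | inj₁ l<x  = trans (go x (ℕ.s≤s⁻¹ l<x) (<⇒≤ x≤u)) (step x (ℕ.s≤s⁻¹ l<x) x≤u)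

module LowerBound (n K : ℕ) (0<n : 0 < n) (2≤K : 2 ≤ K) (n-even : ∃ λ q → n ≡ 2 * q) where
  open Wall n K 0<n 2≤K
  open Drawing n K 0<n 2≤K using (0<w)
  open Graph graph using (Vertex; _~_)

  alternate-n : ∀ {A : Set} (a b : A) → alternate n a b ≡ a
  alternate-n a b = trans (cong (λ t → alternate t a b) (proj₂ n-even)) (alternate-even (proj₁ n-even) a b)

  -- Clamping makes `at` total, so that functions such as `sgn ∘ D` are defined on all indices and
  -- fit `constant-on`.
  clamp : Site → Site
  clamp (D x)   = D (x ⊓ w)
  clamp (S s t) = S s (t ⊓ n)
  clamp (T x)   = T (x ⊓ w)

  clamp-valid : ∀ σ → Valid (clamp σ)
  clamp-valid (D x)   = m⊓n≤n x w
  clamp-valid (S s t) = m⊓n≤n t n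
  clamp-valid (T x)   = m⊓n≤n x w

  clamp-id : ∀ σ → Valid σ → clamp σ ≡ σ
  clamp-id (D x)   v = cong D (m≤n⇒m⊓n≡m v)
  clamp-id (S s t) v = cong (S s) (m≤n⇒m⊓n≡m v)
  clamp-id (T x)   v = cong T (m≤n⇒m⊓n≡m v)

  at : Site → Vertex
  at σ = place (clamp σ) (clamp-valid σ)

  site-at : ∀ {σ} → Valid σ → site (at σ) ≡ σ
  site-at {σ} v = trans (site-place (clamp σ) (clamp-valid σ)) (clamp-id σ v)

  adjacent : ∀ {σ τ} → Valid σ → Valid τ → Link σ τ → at σ ~ at τ
  adjacent v v′ l = inj₁ (subst₂ Link (sym (site-at v)) (sym (site-at v′)) l)

  -- Fewer than three colours

  not-1-packable : ¬ AllPackable graph 1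
  not-1-packable all = proper (adjacent {D 0} {D 1} z≤n 0<w rowD) (trans (only (at (D 0))) (sym (only (at (D 1)))))
    where
    lists : ListAssignment graph
    lists _ = record { elements = 0 ∷ [] ; unique = [] ∷ [] }
    packing : Packing graph 1 lists
    packing = all lists λ _ → refl
    open Packing packing
    open IsListColoring (isColoring 0F)
    only : ∀ u → coloring 0F u ≡ 0
    only u with from-list u
    ... | here eq = eq

  -- The cycle of a gadget has `n + 3` vertices. This is odd, so two colours shared by all lists do
  -- not even admit a single colouring.
  not-2-packable : ¬ AllPackable graph 2
  not-2-packable all = c-proper l≤w r≤w (closer {0F} refl refl)
    (other (two (T l)) (two (S 0F n)) (two (T r)) b≢ (c-proper {S 0F n} ≤-refl r≤w (up refl) ∘ sym))
    where
    lists : ListAssignment graph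
    lists _ = record { elements = 0 ∷ 1 ∷ [] ; unique = ((λ ()) ∷ []) ∷ [] ∷ [] }
    packing : Packing graph 2 lists
    packing = all lists λ _ → refl
    open Packing packing
    open IsListColoring (isColoring 0F)

    l r : ℕ
    l = X 0F 0
    r = X 0F n

    l≤w : l ≤ w
    l≤w = <⇒≤ (X<w 0F z≤n)

    r≤w : r ≤ w
    r≤w = <⇒≤ (X<w 0F ≤-refl)

    c : Site → ℕ
    c σ = coloring 0F (at σ)

    two : ∀ σ → c σ ∈ 0 ∷ 1 ∷ []
    two σ = from-list (at σ)

    c-proper : ∀ {σ τ} → Valid σ → Valid τ → Link σ τ → c σ ≢ c τ
    c-proper v v′ link = proper (adjacent v v′ link)

    other : ∀ {x y z} → x ∈ 0 ∷ 1 ∷ [] → y ∈ 0 ∷ 1 ∷ [] → z ∈ 0 ∷ 1 ∷ [] → x ≢ y → z ≢ y → x ≡ z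
    other (here refl)         _                   (here refl)         _   _   = refl
    other (there (here refl)) _                   (there (here refl)) _   _   = refl
    other (here refl)         (here refl)         (there (here refl)) x≢y _   = ⊥-elim (x≢y refl)
    other (here refl)         (there (here refl)) (there (here refl)) _   z≢y = ⊥-elim (z≢y refl)
    other (there (here refl)) (there (here refl)) (here refl)         x≢y _   = ⊥-elim (x≢y refl)
    other (there (here refl)) (here refl)         (here refl)         _   z≢y = ⊥-elim (z≢y refl)

    spine-colour : ∀ t → t ≤ n → c (S 0F t) ≡ alternate t (c (S 0F 0)) (c (T l))
    spine-colour zero    _   = refl
    spine-colour (suc t) t<n with parity t
    ... | even e = trans (other (two (S 0F (suc t))) (two (S 0F 0)) (two (T l))
            (λ eq → c-proper {S 0F t} {S 0F (suc t)} (<⇒≤ t<n) t<n spine (trans (spine-colour t (<⇒≤ t<n)) (trans (e _ _) (sym eq))))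
            (c-proper {S 0F 0} z≤n l≤w (up refl) ∘ sym)) (sym (e _ _))
    ... | odd e = trans (other (two (S 0F (suc t))) (two (T l)) (two (S 0F 0))
            (λ eq → c-proper {S 0F t} {S 0F (suc t)} (<⇒≤ t<n) t<n spine (trans (spine-colour t (<⇒≤ t<n)) (trans (e _ _) (sym eq))))
            (c-proper {S 0F 0} z≤n l≤w (up refl))) (sym (e _ _))

    b≢ : c (T l) ≢ c (S 0F n)
    b≢ eq = c-proper {S 0F 0} z≤n l≤w (up refl) (sym (trans eq (trans (spine-colour n ≤-refl) (alternate-n _ _))))

  X-digit-< : ∀ {s s′} t {t′} → t ≤ n → toℕ s < toℕ s′ → X s t < X s′ t′
  X-digit-< {s} {s′} t t≤n s<s′ = *-monoʳ-< K (col-mono-digit {s} {s′} t t≤n s<s′)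

  -- Row D has lists A, C, C below the three gadgets, and row T has lists B, B, A above them.
  kind : Site → Kind
  kind (D x) with x <? X 1F 0
  ... | yes _ = 0F
  ... | no _  = 2F
  kind (S s t) = alternate t (outerKind s) (innerKind s)
  kind (T x) with x <? X 2F 0
  ... | yes _ = 1F
  ... | no _  = 0F

  kind-D-A : ∀ {x} → x < X 1F 0 → kind (D x) ≡ 0F
  kind-D-A {x} lt with x <? X 1F 0
  ... | yes _ = refl
  ... | no x≮ = ⊥-elim (x≮ lt)

  kind-D-C : ∀ {x} → X 1F 0 ≤ x → kind (D x) ≡ 2F
  kind-D-C {x} le with x <? X 1F 0
  ... | yes lt = ⊥-elim (<⇒≱ lt le)
  ... | no _   = refl

  kind-T-B : ∀ {x} → x < X 2F 0 → kind (T x) ≡ 1F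
  kind-T-B {x} lt with x <? X 2F 0
  ... | yes _ = refl
  ... | no x≮ = ⊥-elim (x≮ lt)

  kind-T-A : ∀ {x} → X 2F 0 ≤ x → kind (T x) ≡ 0F
  kind-T-A {x} le with x <? X 2F 0
  ... | yes lt = ⊥-elim (<⇒≱ lt le)
  ... | no _   = refl

  palette : Kind → FinSet
  palette k = record
    { elements = colour k 0F ∷ colour k 1F ∷ colour k 2F ∷ []
    ; unique   = (distinct k (λ ()) ∷ distinct k (λ ()) ∷ []) ∷ (distinct k (λ ()) ∷ []) ∷ [] ∷ []
    }
    where
    distinct : ∀ k {i j} → i ≢ j → colour k i ≢ colour k j
    distinct k i≢j = i≢j ∘ colour-injective k _ _

  palette-index : ∀ k {a} → a ∈ˢ palette k → ∃ λ i → a ≡ colour k i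
  palette-index k (here eq)                 = 0F , eq
  palette-index k (there (here eq))         = 1F , eq
  palette-index k (there (there (here eq))) = 2F , eq

  -- Three colours

  module _ (P : Packing graph 3 (palette ∘ kind ∘ site)) where
    open Packing P

    as-perm : ∀ u → ∃ λ p → ∀ i → coloring i u ≡ colour (kind (site u)) (entry p i)
    as-perm u = proj₁ found , entries (proj₂ found)
      where
      k = kind (site u)
      index : ∀ i → ∃ λ j → coloring i u ≡ colour k j
      index i = palette-index k (IsListColoring.from-list (isColoring i) u)
      distinct : ∀ {i j} → i ≢ j → proj₁ (index i) ≢ proj₁ (index j)
      distinct {i} {j} i≢j eq = disjoint u i≢j (trans (proj₂ (index i)) (trans (cong (colour k) eq) (sym (proj₂ (index j)))))
      found = to-perm (proj₁ (index 0F)) (proj₁ (index 1F)) (proj₁ (index 2F)) (distinct λ ()) (distinct λ ()) (distinct λ ())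
      entries : ∀ {p} → entry p 0F ≡ proj₁ (index 0F) × entry p 1F ≡ proj₁ (index 1F) × entry p 2F ≡ proj₁ (index 2F) →
        ∀ i → coloring i u ≡ colour k (entry p i)
      entries (e , _ , _) 0F = trans (proj₂ (index 0F)) (cong (colour k) (sym e))
      entries (_ , e , _) 1F = trans (proj₂ (index 1F)) (cong (colour k) (sym e))
      entries (_ , _ , e) 2F = trans (proj₂ (index 2F)) (cong (colour k) (sym e))

    perm : Site → Perm
    perm σ = proj₁ (as-perm (at σ))

    coloring≡ : ∀ {σ} → Valid σ → ∀ i → coloring i (at σ) ≡ colour (kind σ) (entry (perm σ) i)
    coloring≡ {σ} v i = trans (proj₂ (as-perm (at σ)) i) (cong (λ τ → colour (kind τ) (entry (perm σ) i)) (site-at v))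

    compatible : ∀ {σ τ k l} → Valid σ → Valid τ → Link σ τ → kind σ ≡ k → kind τ ≡ l → Compatible k (perm σ) l (perm τ)
    compatible v v′ link refl refl i eq = IsListColoring.proper (isColoring i) (adjacent v v′ link)
      (trans (coloring≡ v i) (trans eq (sym (coloring≡ v′ i))))

    sgn : Site → Bool
    sgn σ = sign (perm σ)

    sgn-link : ∀ {σ τ k} → Valid σ → Valid τ → Link σ τ → kind σ ≡ k → kind τ ≡ k → sgn σ ≡ sgn τ
    sgn-link {k = k} v v′ link eq eq′ = same-sign k _ _ (compatible v v′ link eq eq′)

    -- The colouring that uses the private colour is the same at all vertices from the left corner
    -- along the spine to the right corner. The corners have equal lists, and across `closer` every
    -- colour must change its colouring.
    gadget : ∀ s {a b} → (∀ {t} → t ≤ n → sgn (S s t) ≡ alternate t a b) →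
      (∀ {t} → t ≤ n → kind (T (X s t)) ≡ innerKind s) → (∀ {t} → t ≤ n → sgn (T (X s t)) ≡ b) →
      opposite s a b ≢ true
    gadget s {a} {b} spine-sign top-kind top-sign opp =
      moved (innerKind s) _ _ (compatible (T-valid z≤n) (T-valid ≤-refl) (closer {s} refl refl) (top-kind z≤n) (top-kind ≤-refl)) _ (begin
        inverse (perm (T (X s 0))) (innerPrivate s) ≡⟨ aligned-up 0 z≤n refl refl ⟨
        location 0                                 ≡⟨ constant-on location (λ t _ t<n → step t t<n) z≤n ≤-refl ⟩
        location n                                 ≡⟨ cong (inverse (perm (S s n))) (alternate-n _ _) ⟩
        inverse (perm (S s n)) (outerPrivate s)     ≡⟨ aligned-up n ≤-refl (alternate-n _ _) (alternate-n _ _) ⟩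
        inverse (perm (T (X s n))) (innerPrivate s) ∎)
      where
      open ≡-Reasoning
      T-valid : ∀ {t} → t ≤ n → X s t ≤ w
      T-valid t≤n = <⇒≤ (X<w s t≤n)

      location : ℕ → Fin 3
      location t = inverse (perm (S s t)) (alternate t (outerPrivate s) (innerPrivate s))

      aligned : ∀ {p q} → Compatible (outerKind s) p (innerKind s) q → sign p ≡ a → sign q ≡ b →
        inverse p (outerPrivate s) ≡ inverse q (innerPrivate s)
      aligned compat refl refl = private-aligned s _ _ compat opp

      aligned-up : ∀ t → t ≤ n → kind (S s t) ≡ outerKind s → alternate t a b ≡ a →
        inverse (perm (S s t)) (outerPrivate s) ≡ inverse (perm (T (X s t))) (innerPrivate s)
      aligned-up t t≤n k≡ a≡ = aligned (compatible {S s t} t≤n (T-valid t≤n) (up {s} refl) k≡ (top-kind t≤n))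
        (trans (spine-sign t≤n) a≡) (top-sign t≤n)

      step : ∀ t → t < n → location t ≡ location (suc t)
      step t t<n with parity t
      ... | even e = begin
        location t ≡⟨ cong (inverse (perm (S s t))) (e _ _) ⟩
        inverse (perm (S s t)) (outerPrivate s) ≡⟨ aligned
          (compatible {S s t} {S s (suc t)} (<⇒≤ t<n) t<n spine (e _ _) (e _ _))
          (trans (spine-sign (<⇒≤ t<n)) (e _ _)) (trans (spine-sign t<n) (e _ _)) ⟩
        inverse (perm (S s (suc t))) (innerPrivate s) ≡⟨ cong (inverse (perm (S s (suc t)))) (e _ _) ⟨
        location (suc t) ∎
      ... | odd e = begin
        location t ≡⟨ cong (inverse (perm (S s t))) (e _ _) ⟩
        inverse (perm (S s t)) (innerPrivate s) ≡⟨ aligned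
          -- At odd positions the inner list comes first, so the edge is read backwards.
          (λ i → compatible {S s t} {S s (suc t)} (<⇒≤ t<n) t<n spine (e _ _) (e _ _) i ∘ sym)
          (trans (spine-sign t<n) (e _ _)) (trans (spine-sign (<⇒≤ t<n)) (e _ _)) ⟨
        inverse (perm (S s (suc t))) (outerPrivate s) ≡⟨ cong (inverse (perm (S s (suc t)))) (e _ _) ⟨
        location (suc t) ∎

    -- The signs that the rows carry for the lists A, B and C.
    a b c : Bool
    a = sgn (D 0)
    b = sgn (T 0)
    c = sgn (D (X 1F 0))

    sign-D-A : ∀ {x} → x < X 1F 0 → sgn (D x) ≡ a
    sign-D-A {x} lt = sym (constant-on (sgn ∘ D) (λ y _ y<x →
      sgn-link (bound (<-trans y<x lt)) (bound (≤-<-trans y<x lt)) rowD (kind-D-A (<-trans y<x lt)) (kind-D-A (≤-<-trans y<x lt)))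
      z≤n ≤-refl)
      where
      bound : ∀ {y} → y < X 1F 0 → y ≤ w
      bound lt = ≤-trans (<⇒≤ lt) (<⇒≤ (X<w 1F z≤n))

    sign-D-C : ∀ {x} → X 1F 0 ≤ x → x ≤ w → sgn (D x) ≡ c
    sign-D-C {x} le x≤w = sym (constant-on (sgn ∘ D) (λ y l≤y y<x →
      sgn-link (≤-trans (<⇒≤ y<x) x≤w) (≤-trans y<x x≤w) rowD (kind-D-C l≤y) (kind-D-C (m≤n⇒m≤1+n l≤y)))
      le ≤-refl)

    sign-T-B : ∀ {x} → x < X 2F 0 → sgn (T x) ≡ b
    sign-T-B {x} lt = sym (constant-on (sgn ∘ T) (λ y _ y<x →
      sgn-link (bound (<-trans y<x lt)) (bound (≤-<-trans y<x lt)) rowT (kind-T-B (<-trans y<x lt)) (kind-T-B (≤-<-trans y<x lt)))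
      z≤n ≤-refl)
      where
      bound : ∀ {y} → y < X 2F 0 → y ≤ w
      bound lt = ≤-trans (<⇒≤ lt) (<⇒≤ (X<w 2F z≤n))

    sign-T-A : ∀ {x} → X 2F 0 ≤ x → x ≤ w → sgn (T x) ≡ a
    sign-T-A {x} le x≤w = begin
      sgn (T x) ≡⟨ constant-on (sgn ∘ T) (λ y x≤y y<w →
        sgn-link (<⇒≤ y<w) y<w rowT (kind-T-A (≤-trans le x≤y)) (kind-T-A (m≤n⇒m≤1+n (≤-trans le x≤y)))) x≤w ≤-refl ⟩
      -- List A occurs in both rows; its sign passes between them over `return`.
      sgn (T w) ≡⟨ sgn-link z≤n ≤-refl (return refl) (kind-D-A (≤-trans (s≤s z≤n) (≤-trans 2≤K (K≤X 1F 0)))) (kind-T-A (≤-trans le x≤w)) ⟨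
      sgn (D 0) ∎
      where open ≡-Reasoning

    outerSign innerSign : Fin 3 → Bool
    outerSign = Vec.lookup (a ∷ c ∷ c ∷ [])
    innerSign = Vec.lookup (b ∷ b ∷ a ∷ [])

    bottom : ∀ s {t} → t ≤ n → kind (D (X s t)) ≡ outerKind s × sgn (D (X s t)) ≡ outerSign s
    bottom 0F {t} t≤n = kind-D-A lt , sign-D-A lt
      where lt = X-digit-< {0F} {1F} t t≤n ≤-refl
    bottom 1F t≤n = kind-D-C le , sign-D-C le (<⇒≤ (X<w 1F t≤n))
      where le = X-mono-≤ 1F z≤n
    bottom 2F t≤n = kind-D-C le , sign-D-C le (<⇒≤ (X<w 2F t≤n))
      where le = <⇒≤ (X-digit-< {1F} {2F} 0 z≤n ≤-refl)

    top : ∀ s {t} → t ≤ n → kind (T (X s t)) ≡ innerKind s × sgn (T (X s t)) ≡ innerSign s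
    top 0F {t} t≤n = kind-T-B lt , sign-T-B lt
      where lt = X-digit-< {0F} {2F} t t≤n (s≤s z≤n)
    top 1F {t} t≤n = kind-T-B lt , sign-T-B lt
      where lt = X-digit-< {1F} {2F} t t≤n ≤-refl
    top 2F t≤n = kind-T-A le , sign-T-A le (<⇒≤ (X<w 2F t≤n))
      where le = X-mono-≤ 2F z≤n

    -- A spine vertex at an even position has the list of its neighbour in row D, at an odd position
    -- that of its neighbour in row T, and so inherits the sign from there.
    spine-sign : ∀ s {t} → t ≤ n → sgn (S s t) ≡ alternate t (outerSign s) (innerSign s)
    spine-sign s {t} t≤n with parity t
    ... | even e = trans (sym (sgn-link {D (X s t)} {S s t} (<⇒≤ (X<w s t≤n)) t≤n (down refl) (proj₁ (bottom s t≤n)) (e _ _)))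
                     (trans (proj₂ (bottom s t≤n)) (sym (e _ _)))
    ... | odd e  = trans (sgn-link {S s t} {T (X s t)} t≤n (<⇒≤ (X<w s t≤n)) (up {s} refl) (e _ _) (proj₁ (top s t≤n)))
                     (trans (proj₂ (top s t≤n)) (sym (e _ _)))

    no-opposite : ∀ s → opposite s (outerSign s) (innerSign s) ≢ true
    no-opposite s = gadget s (spine-sign s) (proj₁ ∘ top s) (proj₂ ∘ top s)

    impossible : ⊥
    impossible with some-opposite a b c
    ... | inj₁ e        = no-opposite 0F e
    ... | inj₂ (inj₁ e) = no-opposite 1F e
    ... | inj₂ (inj₂ e) = no-opposite 2F e

  list-packing-number : IsListPackingNumber graph 4
  list-packing-number = s≤s z≤n , packable , minimal
    where
    minimal : ∀ j → 1 ≤ j → AllPackable graph j → 4 ≤ j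
    minimal 1 _ all = ⊥-elim (not-1-packable all)
    minimal 2 _ all = ⊥-elim (not-2-packable all)
    minimal 3 _ all = ⊥-elim (impossible (all (palette ∘ kind ∘ site) λ _ → refl))
    minimal (suc (suc (suc (suc j)))) _ _ = s≤s (s≤s (s≤s (s≤s z≤n)))

theorem4p1 : ∀ (g : ℕ) → 3 ≤ g →
    ∃ λ (G : Graph) → Planar G × GirthAtLeast g G × IsListPackingNumber G 4
-- Columns at distance `g` and spines of `2 * g + 1` vertices are long enough for the girth, and the
-- even number `2 * g` makes the gadget cycles odd.
theorem4p1 g 3≤g = graph , planar , girth≥ ≤-refl (m≤n⇒m≤1+n (m≤m+n g _)) , list-packing-number
  where
  2≤g : 2 ≤ g
  2≤g = <⇒≤ 3≤g

  0<2*g : 0 < 2 * g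
  0<2*g = ≤-trans (≤-trans (s≤s z≤n) 2≤g) (m≤m+n g _)

  open Wall (2 * g) g 0<2*g 2≤g
  open Drawing (2 * g) g 0<2*g 2≤g
  open LowerBound (2 * g) g 0<2*g 2≤g (g , refl)
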